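{- Let $n\in\mathbb{N}$. For all integers $0\le k\le n$, there exists a bijection between the $k$-dimensional faces of the permutohedron $P(n)$ of order $n$ and the unit-interval parking functions of length $n$ with total displacement $k$.
   Context: The permutohedron of order $n$ is $P(n)=\operatorname{conv}\{(w(1),\dots,w(n)) : w \text{ a permutation of } [n]\}\subset\mathbb{R}^n$, an $(n-1)$-dimensional polytope; its faces include $P(n)$ itself. A parking function of length $n$ is $\alpha=(a_1,\dots,a_n)\in[n]^n$ such that, when cars $1,\dots,n$ arrive in order on a one-way street with spots $1,\dots,n$ and car $i$ parks in the first unoccupied spot $\ge a_i$, every car parks. If car $i$ parks in spot $s_i$, its displacement is $s_i-a_i$, and the total displacement is $\sum_i(s_i-a_i)$. A unit-interval parking function is one in which every car has displacement at most $1$.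
   Formalization: Faces of P(n) are given by their vertex sets as exposed by rational (not real) linear functionals, and affine independence is taken over the rationals; since P(n) has integer vertices, this gives the same faces and dimensions. -}

module Defs where

open import Level using (0ℓ)
open import Data.Nat as ℕ using (ℕ; zero; suc; _∸_; _≡ᵇ_)
open import Data.Bool using (Bool; if_then_else_)
open import Data.Fin using (Fin; toℕ) renaming (zero to fzero; suc to fsuc)
open import Data.Fin.Permutation using (Permutation′; _⟨$⟩ʳ_)
open import Data.Vec using (Vec; toList)
open import Data.List using (List; []; _∷_; zipWith; map)
open import Data.Bool.ListAction using (any)
open import Data.Nat.ListAction using (sum)
open import Data.List.Relation.Unary.All using (All)
open import Data.Maybe using (Maybe; just; nothing)
import Data.Maybe as Maybe
open import Data.Rational using (ℚ; 0ℚ; _+_; _*_; _-_; _≤_)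
import Data.Rational as ℚ
import Data.Integer as ℤ
open import Data.Product using (Σ; _×_; _,_; ∃; proj₁; proj₂)
open import Relation.Nullary using (¬_)
open import Relation.Binary.PropositionalEquality using (_≡_)
open import Relation.Binary.Bundles using (Setoid)
open import Function using (id; _∘_)

Σℚ : ∀ {m} → (Fin m → ℚ) → ℚ
Σℚ {zero}  f = 0ℚ
Σℚ {suc m} f = f fzero + Σℚ (f ∘ fsuc)

_·_ : ∀ {n} → (Fin n → ℚ) → (Fin n → ℚ) → ℚ
c · x = Σℚ (λ i → c i * x i)

-- The permutohedron P(n) = conv { (w(1),…,w(n)) : w ∈ S_n }

vertex : ∀ {n} → Permutation′ n → Fin n → ℚ
vertex w i = ℤ.+ (suc (toℕ (w ⟨$⟩ʳ i))) ℚ./ 1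

-- w lies in the face of P(n) exposed by the linear functional c,
-- i.e. its vertex maximises c over all vertices of P(n)
-- (c = 0 gives the improper face P(n) itself).
InFace : ∀ {n} → (Fin n → ℚ) → Permutation′ n → Set
InFace c w = ∀ w′ → c · vertex w′ ≤ c · vertex w

AffinelyIndependent : ∀ {n k} → (Fin (suc k) → (Fin n → ℚ)) → Set
AffinelyIndependent {n} {k} p =
  (λ′ : Fin k → ℚ) →
  (∀ j → Σℚ (λ i → λ′ i * (p (fsuc i) j - p fzero j)) ≡ 0ℚ) →
  ∀ i → λ′ i ≡ 0ℚ

HasIndepVertices : ∀ {n} → (Fin n → ℚ) → ℕ → Set
HasIndepVertices {n} c k =
  Σ (Fin (suc k) → Permutation′ n) λ v →
    (∀ i → InFace c (v i)) × AffinelyIndependent (vertex ∘ v)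

-- the face exposed by c has dimension k: the affine hull of its vertices
-- (= of the face) has dimension k, i.e. the maximal number of affinely
-- independent vertices of the face is k+1
FaceDim : ∀ {n} → (Fin n → ℚ) → ℕ → Set
FaceDim c k = HasIndepVertices c k × ¬ HasIndepVertices c (suc k)

-- k-dimensional faces of P(n): given by an exposing functional; two
-- functionals give the same face iff they have the same vertex set.
Face : ℕ → ℕ → Set
Face n k = Σ (Fin n → ℚ) λ c → FaceDim c k

_≈F_ : ∀ {n k} → Face n k → Face n k → Set
(c , _) ≈F (d , _) = ∀ w → (InFace c w → InFace d w) × (InFace d w → InFace c w)

FaceSetoid : ℕ → ℕ → Setoid 0ℓ 0ℓ
FaceSetoid n k = record
  { Carrier = Face n k
  ; _≈_ = _≈F_
  ; isEquivalence = record
    { refl = λ w → id , id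
    ; sym = λ p w → proj₂ (p w) , proj₁ (p w)
    ; trans = λ p q w → (proj₁ (q w) ∘ proj₁ (p w)) , (proj₂ (p w) ∘ proj₂ (q w))
    }
  }

-- Parking functions.  Preferences and spots are 0-based here
-- (a ∈ Fin n stands for a+1 ∈ [n]); displacements are unaffected.

isOcc : ℕ → List ℕ → Bool
isOcc a occ = any (λ s → s ≡ᵇ a) occ

firstFree : List ℕ → ℕ → ℕ → Maybe ℕ
firstFree occ a zero    = nothing
firstFree occ a (suc f) = if isOcc a occ then firstFree occ (suc a) f else just a

parkFrom : ℕ → List ℕ → List ℕ → Maybe (List ℕ)
parkFrom n occ [] = just []
parkFrom n occ (a ∷ as) with firstFree occ a (n ∸ a)
... | nothing = nothing
... | just s  = Maybe.map (s ∷_) (parkFrom n (s ∷ occ) as)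

prefs : ∀ {n} → Vec (Fin n) n → List ℕ
prefs α = map toℕ (toList α)

displacements : ∀ {n} → Vec (Fin n) n → Maybe (List ℕ)
displacements {n} α = Maybe.map (λ ss → zipWith _∸_ ss (prefs α)) (parkFrom n [] (prefs α))

IsParkingFunction : ∀ {n} → Vec (Fin n) n → Set
IsParkingFunction {n} α = ∃ λ ss → parkFrom n [] (prefs α) ≡ just ss

IsUIPFDisp : ∀ {n} → ℕ → Vec (Fin n) n → Set
IsUIPFDisp k α = Σ (List ℕ) λ ds →
  displacements α ≡ just ds × All (λ d → d ℕ.≤ 1) ds × sum ds ≡ k

UIPF : ℕ → ℕ → Set
UIPF n k = Σ (Vec (Fin n) n) (IsUIPFDisp k)

UIPFSetoid : ℕ → ℕ → Setoid 0ℓ 0ℓ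
UIPFSetoid n k = record
  { Carrier = UIPF n k
  ; _≈_ = λ x y → proj₁ x ≡ proj₁ y
  ; isEquivalence = record
    { refl = Relation.Binary.PropositionalEquality.refl
    ; sym = Relation.Binary.PropositionalEquality.sym
    ; trans = Relation.Binary.PropositionalEquality.trans
    }
  }

{-# OPTIONS --safe #-}
module Submission where

-- A functional c exposes the vertices w with c i < c j ⇒ w i < w j, so a face is a weak
-- order on [n] (the order of the values of c), and its dimension is the number of
-- repeated indices, those whose value already occurs at a smaller index.  Let car i park
-- at its rank in the lexicographic order of the pairs (c i , i), and prefer that spot if
-- i is not repeated, the spot just before it otherwise: the latter is then taken by the
-- previous car of the same level.  Conversely, the lucky cars of a unit-interval parking
-- function cut the street into blocks inside which the cars are parked in order of
-- arrival, and numbering the blocks from left to right gives back the functional.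

open import Defs
open import Data.Nat using (ℕ; _≤_)
open import Function.Bundles using (Bijection)
open import Data.Nat using (zero; suc; z≤n; s≤s; _∸_; _≡ᵇ_)
import Data.Nat as ℕ
import Data.Nat.Properties as ℕ
open import Data.Nat.ListAction using (sum)
import Data.Integer as ℤ
import Data.Integer.Properties as ℤ
open import Data.Fin using (Fin; zero; suc; toℕ; fromℕ<; punchIn; punchOut; inject≤)
open import Data.Fin.Properties using (toℕ-injective; toℕ-fromℕ<; any?; punchIn-punchOut; punchOut-injective; injective⇒≤; inject≤-injective)
import Data.Fin.Properties as Fin
open import Data.Fin.Permutation using (Permutation′; _⟨$⟩ʳ_; _⟨$⟩ˡ_; inverseˡ; inverseʳ; permutation; transpose; _∘ₚ_)
open import Data.Rational using (ℚ; 0ℚ; 1ℚ; _+_; _*_; _-_; -_; _<_; _/_; toℚᵘ; nonNegative; positive)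
import Data.Rational as ℚ
open import Data.Rational.Properties hiding (_≟_; _≤?_; _<?_)
open import Data.Rational.Solver using (module +-*-Solver)
import Data.Rational.Unnormalised as ℚᵘ
import Data.Rational.Unnormalised.Properties as ℚᵘ
open import Data.Bool using (true; false; T; if_then_else_)
open import Data.Bool.Properties using (T-≡)
open import Data.List using (List; []; _∷_; zipWith; tabulate; map)
open import Data.List.Properties using (tabulate-cong; ∷-injective)
open import Data.List.Membership.Propositional using (_∈_; _∉_)
open import Data.List.Relation.Unary.Any using (here; there)
open import Data.List.Relation.Unary.All using (All; []; _∷_)
open import Data.List.Relation.Unary.All.Properties using (tabulate⁺)
open import Data.Vec as Vec using (Vec; []; _∷_)
open import Data.Vec.Properties using (lookup∘tabulate; tabulate∘lookup)
import Data.Vec.Properties as Vec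
import Data.Vec.Functional as Vector
open import Data.Maybe as Maybe using (just; nothing)
open import Data.Maybe.Properties using (just-injective)
open import Data.Product using (Σ; ∃; _×_; _,_; proj₁; proj₂)
open import Data.Sum using (_⊎_; inj₁; inj₂; [_,_]′)
open import Data.Unit using (tt)
open import Function using (_∘_; Injective; Equivalence)
open import Relation.Nullary using (¬_; Dec; yes; no; does; contradiction; ¬?; _×-dec_; _⊎-dec_)
open import Relation.Nullary.Decidable using (dec-true; dec-false)
open import Relation.Binary.Definitions using (tri<; tri≈; tri>)
open import Relation.Binary.PropositionalEquality using (_≡_; _≢_; refl; sym; trans; cong; cong₂; subst; subst₂; module ≡-Reasoning)
import Algebra.Properties.CommutativeMonoid.Sum +-0-commutativeMonoid as Sum
import Algebra.Properties.CommutativeMonoid.Sum ℕ.+-0-commutativeMonoid as Sumℕ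

open +-*-Solver using (solve; _:+_; _:*_; _:-_; :-_; _:=_; con)

-- The dimension is bounded below by exchanging values inside levels. It is bounded above because
-- all vertices of the face have the same coordinate sum on each level, so that one coordinate per
-- level is determined by the others. A face has many exposing functionals, so only comparisons
-- between values of `c` may matter: equality of faces becomes equality of weak orders, tested one
-- direction at a time by `_⊑_`. Injectivity needs no inverse map: parking the cars of
-- `preferences c` returns the ranks, the displacements then mark the repeated indices, and these
-- two data determine the weak order.

variable
  m n : ℕ

-- Finite sums of rationals

Σℚ≡sum : (f : Fin n → ℚ) → Σℚ f ≡ Sum.sum f
Σℚ≡sum {zero}  f = refl
Σℚ≡sum {suc n} f = cong (f zero +_) (Σℚ≡sum (f ∘ suc))

Σℚ-cong : {f g : Fin n → ℚ} → (∀ i → f i ≡ g i) → Σℚ f ≡ Σℚ g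
Σℚ-cong {zero}  eq = refl
Σℚ-cong {suc n} eq = cong₂ _+_ (eq zero) (Σℚ-cong (eq ∘ suc))

Σℚ-+ : (f g : Fin n → ℚ) → Σℚ (λ i → f i + g i) ≡ Σℚ f + Σℚ g
Σℚ-+ f g = trans (Σℚ≡sum (λ i → f i + g i)) (trans (Sum.∑-distrib-+ f g) (sym (cong₂ _+_ (Σℚ≡sum f) (Σℚ≡sum g))))

Σℚ-*ˡ : ∀ a (f : Fin n → ℚ) → Σℚ (λ i → a * f i) ≡ a * Σℚ f
Σℚ-*ˡ {zero}  a f = sym (*-zeroʳ a)
Σℚ-*ˡ {suc n} a f = trans (cong (a * f zero +_) (Σℚ-*ˡ a (f ∘ suc))) (sym (*-distribˡ-+ a _ _))

Σℚ-neg : (f : Fin n → ℚ) → Σℚ (λ i → - f i) ≡ - Σℚ f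
Σℚ-neg {zero}  f = refl
Σℚ-neg {suc n} f = trans (cong (_+_ (- f zero)) (Σℚ-neg (f ∘ suc))) (sym (neg-distrib-+ (f zero) (Σℚ (f ∘ suc))))

Σℚ-- : (f g : Fin n → ℚ) → Σℚ (λ i → f i - g i) ≡ Σℚ f - Σℚ g
Σℚ-- f g = trans (Σℚ-+ f (λ i → - g i)) (cong (_+_ (Σℚ f)) (Σℚ-neg g))

Σℚ-zero : (f : Fin n → ℚ) → (∀ i → f i ≡ 0ℚ) → Σℚ f ≡ 0ℚ
Σℚ-zero {zero}  f eq = refl
Σℚ-zero {suc n} f eq = trans (cong₂ _+_ (eq zero) (Σℚ-zero (f ∘ suc) (eq ∘ suc))) (+-identityˡ 0ℚ)

Σℚ-comm : (f : Fin m → Fin n → ℚ) → Σℚ (λ i → Σℚ (f i)) ≡ Σℚ (λ j → Σℚ (λ i → f i j))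
Σℚ-comm f = begin
  Σℚ (λ i → Σℚ (f i))                      ≡⟨ Σℚ-cong (λ i → Σℚ≡sum (f i)) ⟩
  Σℚ (λ i → Sum.sum (f i))                 ≡⟨ Σℚ≡sum (λ i → Sum.sum (f i)) ⟩
  Sum.sum (λ i → Sum.sum (f i))            ≡⟨ Sum.∑-comm f ⟩
  Sum.sum (λ j → Sum.sum (λ i → f i j))    ≡⟨ Σℚ≡sum (λ j → Sum.sum (λ i → f i j)) ⟨
  Σℚ (λ j → Sum.sum (λ i → f i j))         ≡⟨ Σℚ-cong (λ j → Σℚ≡sum (λ i → f i j)) ⟨
  Σℚ (λ j → Σℚ (λ i → f i j))              ∎
  where open ≡-Reasoning

Σℚ-permute : (f : Fin n → ℚ) (w : Permutation′ n) → Σℚ (λ i → f (w ⟨$⟩ʳ i)) ≡ Σℚ f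
Σℚ-permute f w = trans (Σℚ≡sum (λ i → f (w ⟨$⟩ʳ i))) (trans (sym (Sum.sum-permute f w)) (sym (Σℚ≡sum f)))

Σℚ-nonneg : (f : Fin n → ℚ) → (∀ i → 0ℚ ℚ.≤ f i) → 0ℚ ℚ.≤ Σℚ f
Σℚ-nonneg {zero}  f p = ≤-refl
Σℚ-nonneg {suc n} f p = +-mono-≤ (p zero) (Σℚ-nonneg (f ∘ suc) (p ∘ suc))

Σℚ-single : (f : Fin n → ℚ) (i : Fin n) → (∀ l → l ≢ i → f l ≡ 0ℚ) → Σℚ f ≡ f i
Σℚ-single f zero    p = trans (cong (f zero +_) (Σℚ-zero (f ∘ suc) (λ l → p (suc l) λ ()))) (+-identityʳ _)
Σℚ-single f (suc i) p = trans (cong₂ _+_ (p zero λ ()) (Σℚ-single (f ∘ suc) i (λ l l≢i → p (suc l) (l≢i ∘ Fin.suc-injective)))) (+-identityˡ _)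

Σℚ-pair : (f : Fin n → ℚ) {i j : Fin n} → i ≢ j → (∀ l → l ≢ i → l ≢ j → f l ≡ 0ℚ) → Σℚ f ≡ f i + f j
Σℚ-pair f {zero}  {zero}  i≢j p = contradiction refl i≢j
Σℚ-pair f {zero}  {suc j} i≢j p = cong (f zero +_) (Σℚ-single (f ∘ suc) j (λ l l≢j → p (suc l) (λ ()) (l≢j ∘ Fin.suc-injective)))
Σℚ-pair f {suc i} {zero}  i≢j p = trans (cong (f zero +_) (Σℚ-single (f ∘ suc) i (λ l l≢i → p (suc l) (l≢i ∘ Fin.suc-injective) (λ ())))) (+-comm (f zero) (f (suc i)))
Σℚ-pair f {suc i} {suc j} i≢j p = trans (cong₂ _+_ (p zero (λ ()) (λ ())) (Σℚ-pair (f ∘ suc) (i≢j ∘ cong suc)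
  (λ l l≢i l≢j → p (suc l) (l≢i ∘ Fin.suc-injective) (l≢j ∘ Fin.suc-injective)))) (+-identityˡ _)

p≤q⇒0≤q-p : ∀ {p q} → p ℚ.≤ q → 0ℚ ℚ.≤ q - p
p≤q⇒0≤q-p {p} {q} p≤q = subst (ℚ._≤ q - p) (+-inverseʳ p) (+-monoˡ-≤ (- p) p≤q)

0≤q-p⇒p≤q : ∀ {p q} → 0ℚ ℚ.≤ q - p → p ℚ.≤ q
0≤q-p⇒p≤q {p} {q} 0≤ = subst₂ ℚ._≤_ (+-identityˡ p) (solve 2 (λ p q → (q :- p) :+ p := q) refl p q) (+-monoˡ-≤ p 0≤)

p<q⇒0<q-p : ∀ {p q} → p < q → 0ℚ < q - p
p<q⇒0<q-p {p} {q} p<q = subst (_< q - p) (+-inverseʳ p) (+-monoˡ-< (- p) p<q)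

p-q≡0⇒p≡q : ∀ {p q} → p - q ≡ 0ℚ → p ≡ q
p-q≡0⇒p≡q {p} {q} eq = trans (solve 2 (λ p q → p := (p :- q) :+ q) refl p q) (trans (cong (_+ q) eq) (+-identityˡ q))

*-nonneg : ∀ {p q} → 0ℚ ℚ.≤ p → 0ℚ ℚ.≤ q → 0ℚ ℚ.≤ p * q
*-nonneg {p} {q} 0≤p 0≤q = subst (ℚ._≤ p * q) (*-zeroʳ p) (*-monoˡ-≤-nonNeg p {{nonNegative 0≤p}} 0≤q)

*-pos : ∀ {p q} → 0ℚ < p → 0ℚ < q → 0ℚ < p * q
*-pos {p} {q} 0<p 0<q = subst (_< p * q) (*-zeroˡ q) (*-monoˡ-<-pos q {{positive 0<q}} 0<p)

*-cancel-zero : ∀ {p q} → q ≢ 0ℚ → p * q ≡ 0ℚ → p ≡ 0ℚ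
*-cancel-zero {p} {q} q≢0 pq≡0 with <-cmp p 0ℚ | <-cmp q 0ℚ
... | tri≈ _ p≡0 _ | _            = p≡0
... | _            | tri≈ _ q≡0 _ = contradiction q≡0 q≢0
... | tri< p<0 _ _ | tri< q<0 _ _ = contradiction (sym (trans (solve 2 (λ p q → :- p :* :- q := p :* q) refl p q) pq≡0)) (<⇒≢ (*-pos (neg-antimono-< p<0) (neg-antimono-< q<0)))
... | tri< p<0 _ _ | tri> _ _ 0<q = contradiction (sym (trans (solve 2 (λ p q → :- p :* q := :- (p :* q)) refl p q) (cong -_ pq≡0))) (<⇒≢ (*-pos (neg-antimono-< p<0) 0<q))
... | tri> _ _ 0<p | tri< q<0 _ _ = contradiction (sym (trans (solve 2 (λ p q → p :* :- q := :- (p :* q)) refl p q) (cong -_ pq≡0))) (<⇒≢ (*-pos 0<p (neg-antimono-< q<0)))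
... | tri> _ _ 0<p | tri> _ _ 0<q = contradiction (sym pq≡0) (<⇒≢ (*-pos 0<p 0<q))

-- Vertices of a face

ι : ℕ → ℚ
ι a = ℤ.+ a / 1

ι-suc : ∀ a → ι (suc a) ≡ 1ℚ + ι a
ι-suc a = toℚᵘ-injective (begin
  toℚᵘ (ι (suc a))                         ≈⟨ toℚᵘ-fromℚᵘ (ℚᵘ.mkℚᵘ (ℤ.+ suc a) 0) ⟩
  ℚᵘ.mkℚᵘ (ℤ.+ suc a) 0                      ≈⟨ ℚᵘ.*≡* (cong (ℤ._* ℤ.+ 1) (cong (λ z → ℤ.+ 1 ℤ.+ z) (sym (ℤ.*-identityʳ (ℤ.+ a))))) ⟩
  ℚᵘ.1ℚᵘ ℚᵘ.+ ℚᵘ.mkℚᵘ (ℤ.+ a) 0              ≈⟨ ℚᵘ.+-congʳ ℚᵘ.1ℚᵘ (toℚᵘ-fromℚᵘ (ℚᵘ.mkℚᵘ (ℤ.+ a) 0)) ⟨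
  toℚᵘ 1ℚ ℚᵘ.+ toℚᵘ (ι a)                  ≈⟨ toℚᵘ-homo-+ 1ℚ (ι a) ⟨
  toℚᵘ (1ℚ + ι a)                          ∎)
  where open ℚᵘ.≃-Reasoning

ι-mono-≤ : ∀ {a b} → a ℕ.≤ b → ι a ℚ.≤ ι b
ι-mono-≤ {b = zero}  z≤n = ≤-refl
ι-mono-≤ {b = suc b} z≤n = subst (ι 0 ℚ.≤_) (sym (ι-suc b)) (+-mono-≤ {0ℚ} {1ℚ} {0ℚ} (nonNegative⁻¹ 1ℚ) (ι-mono-≤ {b = b} z≤n))
ι-mono-≤ (s≤s {a} {b} a≤b) = subst₂ ℚ._≤_ (sym (ι-suc a)) (sym (ι-suc b)) (+-monoʳ-≤ 1ℚ (ι-mono-≤ a≤b))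

ι-mono-< : ∀ {a b} → a ℕ.< b → ι a < ι b
ι-mono-< {a} {b} a<b = <-≤-trans (subst₂ _<_ (+-identityˡ (ι a)) (sym (ι-suc a)) (+-monoˡ-< (ι a) (positive⁻¹ 1ℚ))) (ι-mono-≤ a<b)

ι-cancel-< : ∀ {a b} → ι a < ι b → a ℕ.< b
ι-cancel-< {a} {b} ιa<ιb with ℕ.<-≤-connex a b
... | inj₁ a<b = a<b
... | inj₂ b≤a = contradiction (<-≤-trans ιa<ιb (ι-mono-≤ b≤a)) (<-irrefl refl)

ι-injective : ∀ {a b} → ι a ≡ ι b → a ≡ b
ι-injective {a} {b} eq with ℕ.<-cmp a b
... | tri< a<b _ _ = contradiction eq (<⇒≢ (ι-mono-< a<b))
... | tri≈ _ a≡b _ = a≡b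
... | tri> _ _ b<a = contradiction (sym eq) (<⇒≢ (ι-mono-< b<a))

χ : ∀ {P : Set} → Dec P → ℚ
χ P? = if does P? then 1ℚ else 0ℚ

χ-yes : ∀ {P : Set} (P? : Dec P) → P → χ P? ≡ 1ℚ
χ-yes P? p = cong (if_then 1ℚ else 0ℚ) (dec-true P? p)

χ-no : ∀ {P : Set} (P? : Dec P) → ¬ P → χ P? ≡ 0ℚ
χ-no P? ¬p = cong (if_then 1ℚ else 0ℚ) (dec-false P? ¬p)

χ-cong : ∀ {P Q : Set} (P? : Dec P) (Q? : Dec Q) → (P → Q) → (Q → P) → χ P? ≡ χ Q?
χ-cong P? (yes q) f g = χ-yes P? (g q)
χ-cong P? (no ¬q) f g = χ-no P? (¬q ∘ f)

χ-bounds : ∀ {P : Set} (P? : Dec P) → 0ℚ ℚ.≤ χ P? × χ P? ℚ.≤ 1ℚ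
χ-bounds (yes _) = nonNegative⁻¹ 1ℚ , ≤-refl
χ-bounds (no _)  = ≤-refl , nonNegative⁻¹ 1ℚ

-- The first indicator alone fixes the sign of the second factor: it is at least 0 if `P` holds and
-- at most 0 otherwise, whatever `Q` is.
χ-difference-nonneg : ∀ {P Q : Set} (P? : Dec P) (Q? : Dec Q) {x y : ℚ} →
  (P → y ℚ.≤ x) → (¬ P → x ℚ.≤ y) → 0ℚ ℚ.≤ (x - y) * (χ P? - χ Q?)
χ-difference-nonneg (yes p) Q? f g = *-nonneg (p≤q⇒0≤q-p (f p)) (p≤q⇒0≤q-p (proj₂ (χ-bounds Q?)))
χ-difference-nonneg (no ¬p) Q? {x} {y} f g = subst (0ℚ ℚ.≤_)
  (solve 3 (λ x y q → (y :- x) :* q := (x :- y) :* (con 0ℚ :- q)) refl x y (χ Q?))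
  (*-nonneg (p≤q⇒0≤q-p (g ¬p)) (proj₁ (χ-bounds Q?)))

-- The layer-cake decomposition, which reduces statements about values of permutations to statements
-- about one threshold at a time.
ι-as-sum : ∀ {n a} → a ℕ.≤ n → Σℚ {n} (λ t → χ (toℕ t ℕ.<? a)) ≡ ι a
ι-as-sum {n} {zero}      a≤n = Σℚ-zero {n} _ (λ t → χ-no (toℕ t ℕ.<? 0) λ ())
ι-as-sum {suc n} {suc a} (s≤s a≤n) = trans
  (cong₂ _+_ (χ-yes (0 ℕ.<? suc a) (s≤s z≤n)) (trans
    (Σℚ-cong {n} (λ t → χ-cong (suc (toℕ t) ℕ.<? suc a) (toℕ t ℕ.<? a) ℕ.s≤s⁻¹ s≤s))
    (ι-as-sum {n} a≤n)))
  (sym (ι-suc a))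

Compatible : (Fin n → ℚ) → Permutation′ n → Set
Compatible c w = ∀ i j → c i < c j → toℕ (w ⟨$⟩ʳ i) ℕ.< toℕ (w ⟨$⟩ʳ j)

vertex-difference : (w w′ : Permutation′ n) (i : Fin n) →
  vertex w i - vertex w′ i ≡ Σℚ {n} (λ t → χ (toℕ t ℕ.<? toℕ (w ⟨$⟩ʳ i)) - χ (toℕ t ℕ.<? toℕ (w′ ⟨$⟩ʳ i)))
vertex-difference {n} w w′ i = begin
  ι (suc a) - ι (suc b)      ≡⟨ cong₂ _-_ (ι-suc a) (ι-suc b) ⟩
  (1ℚ + ι a) - (1ℚ + ι b)    ≡⟨ solve 3 (λ x a b → (x :+ a) :- (x :+ b) := a :- b) refl 1ℚ (ι a) (ι b) ⟩
  ι a - ι b                  ≡⟨ cong₂ _-_ (ι-as-sum {n} (ℕ.<⇒≤ (Fin.toℕ<n (w ⟨$⟩ʳ i)))) (ι-as-sum {n} (ℕ.<⇒≤ (Fin.toℕ<n (w′ ⟨$⟩ʳ i)))) ⟨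
  Σℚ (λ t → χ (below t w)) - Σℚ (λ t → χ (below t w′))    ≡⟨ Σℚ-- {n} (λ t → χ (below t w)) (λ t → χ (below t w′)) ⟨
  Σℚ (λ t → χ (below t w) - χ (below t w′))               ∎
  where
  open ≡-Reasoning
  a = toℕ (w ⟨$⟩ʳ i)
  b = toℕ (w′ ⟨$⟩ʳ i)
  below : (t : Fin n) (u : Permutation′ n) → Dec (toℕ t ℕ.< toℕ (u ⟨$⟩ʳ i))
  below t u = toℕ t ℕ.<? toℕ (u ⟨$⟩ʳ i)

·-difference : (c : Fin n → ℚ) (w w′ : Permutation′ n) →
  c · vertex w - c · vertex w′ ≡ Σℚ (λ i → c i * (vertex w i - vertex w′ i))
·-difference {n} c w w′ = trans (sym (Σℚ-- (λ i → c i * vertex w i) (λ i → c i * vertex w′ i)))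
  (Σℚ-cong {n} (λ i → solve 3 (λ c a b → c :* a :- c :* b := c :* (a :- b)) refl (c i) (vertex w i) (vertex w′ i)))

-- Write w(i) as the number of thresholds t < w(i).  Each threshold contributes
-- Σᵢ c(i) ([t < w(i)] − [t < w′(i)]), and since the brackets sum to 0 over i, c(i)
-- may be replaced by c(i) − c(w⁻¹(t)), after which every term is nonnegative.
compatible⇒inFace : (c : Fin n → ℚ) (w : Permutation′ n) → Compatible c w → InFace c w
compatible⇒inFace {n} c w compat w′ = 0≤q-p⇒p≤q (subst (0ℚ ℚ.≤_) (sym total) (Σℚ-nonneg _ layer-nonneg))
  where
  open ≡-Reasoning
  pivot : Fin n → ℚ
  pivot t = c (w ⟨$⟩ˡ t)
  d : Fin n → Fin n → ℚ
  d t i = χ (toℕ t ℕ.<? toℕ (w ⟨$⟩ʳ i)) - χ (toℕ t ℕ.<? toℕ (w′ ⟨$⟩ʳ i))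
  total : c · vertex w - c · vertex w′ ≡ Σℚ (λ t → Σℚ (λ i → c i * d t i))
  total = begin
    c · vertex w - c · vertex w′                        ≡⟨ ·-difference c w w′ ⟩
    Σℚ (λ i → c i * (vertex w i - vertex w′ i))         ≡⟨ Σℚ-cong (λ i → cong (c i *_) (vertex-difference w w′ i)) ⟩
    Σℚ (λ i → c i * Σℚ (λ t → d t i))                   ≡⟨ Σℚ-cong (λ i → sym (Σℚ-*ˡ (c i) (λ t → d t i))) ⟩
    Σℚ (λ i → Σℚ (λ t → c i * d t i))                   ≡⟨ Σℚ-comm (λ i t → c i * d t i) ⟩
    Σℚ (λ t → Σℚ (λ i → c i * d t i))                   ∎
  d-sum : ∀ t → Σℚ (d t) ≡ 0ℚ
  d-sum t = begin
    Σℚ (d t)      ≡⟨ Σℚ-- {n} _ _ ⟩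
    Σℚ (λ i → χ (toℕ t ℕ.<? toℕ (w ⟨$⟩ʳ i))) - Σℚ (λ i → χ (toℕ t ℕ.<? toℕ (w′ ⟨$⟩ʳ i)))
                  ≡⟨ cong₂ _-_ (Σℚ-permute above w) (Σℚ-permute above w′) ⟩
    Σℚ above - Σℚ above ≡⟨ +-inverseʳ (Σℚ above) ⟩
    0ℚ            ∎
    where
    above : Fin n → ℚ
    above a = χ (toℕ t ℕ.<? toℕ a)
  term-nonneg : ∀ t i → 0ℚ ℚ.≤ (c i - pivot t) * d t i
  -- `pivot t` is the value of `c` at the index that `w` sends to `t`. By compatibility, an index
  -- sent above `t` has a value at least the pivot, and any other index a value at most the pivot.
  term-nonneg t i = χ-difference-nonneg (toℕ t ℕ.<? toℕ (w ⟨$⟩ʳ i)) (toℕ t ℕ.<? toℕ (w′ ⟨$⟩ʳ i))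
    (λ t<wi → ≮⇒≥ λ ci<p → ℕ.<-asym t<wi (subst (λ a → toℕ (w ⟨$⟩ʳ i) ℕ.< toℕ a) (inverseʳ w) (compat _ _ ci<p)))
    (λ t≮wi → ≮⇒≥ λ p<ci → t≮wi (subst (λ a → toℕ a ℕ.< toℕ (w ⟨$⟩ʳ i)) (inverseʳ w) (compat _ _ p<ci)))
  layer-nonneg : ∀ t → 0ℚ ℚ.≤ Σℚ (λ i → c i * d t i)
  layer-nonneg t = subst (0ℚ ℚ.≤_) (begin
    Σℚ (λ i → (c i - pivot t) * d t i)
      ≡⟨ Σℚ-cong (λ i → solve 3 (λ c p d → (c :- p) :* d := c :* d :- p :* d) refl (c i) (pivot t) (d t i)) ⟩
    Σℚ (λ i → c i * d t i - pivot t * d t i)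
      ≡⟨ Σℚ-- (λ i → c i * d t i) (λ i → pivot t * d t i) ⟩
    Σℚ (λ i → c i * d t i) - Σℚ (λ i → pivot t * d t i)
      ≡⟨ cong (λ x → Σℚ (λ i → c i * d t i) - x) (trans (Σℚ-*ˡ (pivot t) (d t)) (trans (cong (pivot t *_) (d-sum t)) (*-zeroʳ (pivot t)))) ⟩
    Σℚ (λ i → c i * d t i) - 0ℚ
      ≡⟨ +-identityʳ _ ⟩
    Σℚ (λ i → c i * d t i) ∎)
    (Σℚ-nonneg _ (term-nonneg t))

-- `_∘ₚ_` composes from left to right, so the transposition acts on indices before `w` is applied.
swapped : Fin n → Fin n → Permutation′ n → Permutation′ n
swapped i j w = transpose i j ∘ₚ w

swapped-left : (i j : Fin n) (w : Permutation′ n) → swapped i j w ⟨$⟩ʳ i ≡ w ⟨$⟩ʳ j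
swapped-left i j w rewrite dec-true (i Fin.≟ i) refl = refl

swapped-right : (i j : Fin n) (w : Permutation′ n) → swapped i j w ⟨$⟩ʳ j ≡ w ⟨$⟩ʳ i
swapped-right i j w with j Fin.≟ i
... | yes refl = refl
... | no _ rewrite dec-true (j Fin.≟ j) refl = refl

swapped-other : (i j : Fin n) (w : Permutation′ n) → ∀ {l} → l ≢ i → l ≢ j → swapped i j w ⟨$⟩ʳ l ≡ w ⟨$⟩ʳ l
swapped-other i j w {l} l≢i l≢j rewrite dec-false (l Fin.≟ i) l≢i | dec-false (l Fin.≟ j) l≢j = refl

-- Exchange argument: if `c i < c j` but `w` is larger at `i` than at `j`, exchanging the two values
-- raises the functional by (c j - c i)(w i - w j) > 0.
inFace⇒compatible : (c : Fin n → ℚ) (w : Permutation′ n) → InFace c w → Compatible c w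
inFace⇒compatible c w face i j ci<cj with ℕ.<-cmp (toℕ (w ⟨$⟩ʳ i)) (toℕ (w ⟨$⟩ʳ j))
... | tri< wi<wj _ _ = wi<wj
... | tri≈ _ wi≡wj _ = contradiction (cong c (trans (sym (inverseˡ w)) (trans (cong (w ⟨$⟩ˡ_) (toℕ-injective wi≡wj)) (inverseˡ w)))) (<⇒≢ ci<cj)
... | tri> _ _ wj<wi = contradiction (face w′) (λ le → <-irrefl refl (<-≤-trans (subst₂ _<_ (+-identityˡ _) (solve 2 (λ x y → (x :- y) :+ y := x) refl (c · vertex w′) (c · vertex w)) (+-monoˡ-< (c · vertex w) gain)) le))
  where
  open ≡-Reasoning
  w′ = swapped i j w
  f : Fin _ → ℚ
  f l = c l * (vertex w′ l - vertex w l)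
  i≢j : i ≢ j
  i≢j refl = <-irrefl refl ci<cj
  value : ∀ l m → w′ ⟨$⟩ʳ l ≡ w ⟨$⟩ʳ m → vertex w′ l ≡ vertex w m
  value l m = cong (λ a → ι (suc (toℕ a)))
  f-other : ∀ l → l ≢ i → l ≢ j → f l ≡ 0ℚ
  f-other l l≢i l≢j = trans (cong (λ x → c l * (x - vertex w l)) (value l l (swapped-other i j w l≢i l≢j)))
    (solve 2 (λ c x → c :* (x :- x) := con 0ℚ) refl (c l) (vertex w l))
  gain : 0ℚ < c · vertex w′ - c · vertex w
  gain = subst (0ℚ <_) (sym (begin
    c · vertex w′ - c · vertex w   ≡⟨ ·-difference c w′ w ⟩
    Σℚ f                           ≡⟨ Σℚ-pair f i≢j f-other ⟩
    f i + f j                      ≡⟨ cong₂ (λ x y → c i * (x - vertex w i) + c j * (y - vertex w j)) (value i j (swapped-left i j w)) (value j i (swapped-right i j w)) ⟩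
    c i * (vertex w j - vertex w i) + c j * (vertex w i - vertex w j)
      ≡⟨ solve 4 (λ a b x y → a :* (y :- x) :+ b :* (x :- y) := (b :- a) :* (x :- y)) refl (c i) (c j) (vertex w i) (vertex w j) ⟩
    (c j - c i) * (vertex w i - vertex w j) ∎))
    (*-pos (p<q⇒0<q-p ci<cj) (p<q⇒0<q-p (ι-mono-< (s≤s wj<wi))))

-- Dimension of a face

-- Fraction-free elimination of the unknown x₀.
homogeneous-system : ∀ {k m} → k ℕ.< m → (A : Fin k → Fin m → ℚ) →
  Σ (Fin m → ℚ) λ x → (∀ j → Σℚ (λ i → x i * A j i) ≡ 0ℚ) × ∃ λ i → x i ≢ 0ℚ
homogeneous-system {zero}  {suc m} _ A = (λ _ → 1ℚ) , (λ ()) , zero , 1≢0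
homogeneous-system {suc k} {suc m} (s≤s k<m) A with any? (λ j → ¬? (A j zero ℚ.≟ 0ℚ))
... | no all-zero = e₀ , solves , zero , 1≢0
  where
  e₀ : Fin (suc m) → ℚ
  e₀ zero    = 1ℚ
  e₀ (suc _) = 0ℚ
  column-zero : ∀ j → A j zero ≡ 0ℚ
  column-zero j with A j zero ℚ.≟ 0ℚ
  ... | yes eq = eq
  ... | no neq = contradiction (j , neq) all-zero
  solves : ∀ j → Σℚ (λ i → e₀ i * A j i) ≡ 0ℚ
  solves j = Σℚ-zero {suc m} (λ i → e₀ i * A j i) λ where
    zero    → trans (*-identityˡ _) (column-zero j)
    (suc i) → *-zeroˡ (A j (suc i))
... | yes (p , pivot≢0) = x , solves , suc i₀ , λ eq → y≢0 (*-cancel-zero pivot≢0 eq)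
  where
  open ≡-Reasoning
  B : Fin k → Fin m → ℚ
  -- The 2×2 minors on the pivot row `p`: x₀ cancels when the pivot multiple of another equation is
  -- reduced by a multiple of equation `p`.
  B j i = A p zero * A (punchIn p j) (suc i) - A (punchIn p j) zero * A p (suc i)
  reduced = homogeneous-system k<m B
  y = proj₁ reduced
  i₀ = proj₁ (proj₂ (proj₂ reduced))
  y≢0 = proj₂ (proj₂ (proj₂ reduced))
  row : Fin (suc k) → ℚ
  row j = Σℚ (λ i → y i * A j (suc i))
  x : Fin (suc m) → ℚ
  -- Scaling `y` by the pivot solves equation `p` for x₀ without division, and keeps the solution
  -- nonzero because the pivot is.
  x zero    = - row p
  x (suc i) = y i * A p zero
  row-x : ∀ j → Σℚ (λ i → x i * A j i) ≡ A p zero * row j - A j zero * row p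
  row-x j = begin
    - row p * A j zero + Σℚ (λ i → (y i * A p zero) * A j (suc i))
      ≡⟨ cong (λ z → - row p * A j zero + z) (trans
           (Σℚ-cong {m} (λ i → solve 3 (λ y a b → (y :* a) :* b := a :* (y :* b)) refl (y i) (A p zero) (A j (suc i))))
           (Σℚ-*ˡ (A p zero) (λ i → y i * A j (suc i)))) ⟩
    - row p * A j zero + A p zero * row j
      ≡⟨ solve 4 (λ r a b s → :- r :* a :+ b :* s := b :* s :- a :* r) refl (row p) (A j zero) (A p zero) (row j) ⟩
    A p zero * row j - A j zero * row p ∎
  row-B : ∀ j → Σℚ (λ i → y i * B j i) ≡ A p zero * row (punchIn p j) - A (punchIn p j) zero * row p
  row-B j = begin
    Σℚ (λ i → y i * B j i)
      ≡⟨ Σℚ-cong {m} (λ i → solve 5 (λ y a b c d → y :* (a :* b :- c :* d) := a :* (y :* b) :- c :* (y :* d)) refl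
           (y i) (A p zero) (A (punchIn p j) (suc i)) (A (punchIn p j) zero) (A p (suc i))) ⟩
    Σℚ (λ i → A p zero * (y i * A (punchIn p j) (suc i)) - A (punchIn p j) zero * (y i * A p (suc i)))
      ≡⟨ Σℚ-- {m} _ _ ⟩
    Σℚ (λ i → A p zero * (y i * A (punchIn p j) (suc i))) - Σℚ (λ i → A (punchIn p j) zero * (y i * A p (suc i)))
      ≡⟨ cong₂ _-_ (Σℚ-*ˡ {m} (A p zero) _) (Σℚ-*ˡ {m} (A (punchIn p j) zero) _) ⟩
    A p zero * row (punchIn p j) - A (punchIn p j) zero * row p ∎
  solves : ∀ j → Σℚ (λ i → x i * A j i) ≡ 0ℚ
  solves j with p Fin.≟ j
  ... | yes refl = trans (row-x p) (+-inverseʳ (A p zero * row p))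
  ... | no p≢j   = subst (λ l → Σℚ (λ i → x i * A l i) ≡ 0ℚ) (punchIn-punchOut p≢j)
                     (trans (row-x _) (trans (sym (row-B _)) (proj₁ (proj₂ reduced) (punchOut p≢j))))

𝟙 : ∀ {P : Set} → Dec P → ℕ
𝟙 P? = if does P? then 1 else 0

count : ∀ {P : Fin n → Set} → (∀ i → Dec (P i)) → ℕ
count {zero}  P? = 0
count {suc n} P? = 𝟙 (P? zero) ℕ.+ count (P? ∘ suc)

-- Turns the repeated indices into a family over `Fin (dimension c)`, so that they can serve as the
-- rows of a linear system.
enumerate : ∀ {P : Fin n → Set} (P? : ∀ i → Dec (P i)) →
  Σ (Fin (count P?) → Fin n) λ e → Injective _≡_ _≡_ e × (∀ a → P (e a)) × (∀ i → P i → ∃ λ a → e a ≡ i)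
enumerate {zero}  P? = (λ ()) , (λ {}) , (λ ()) , (λ ())
enumerate {suc n} {P} P? with P? zero | enumerate (P? ∘ suc)
... | yes p | e , e-inj , e-P , e-surj = e′ , e′-inj , e′-P , e′-surj
  where
  e′ : Fin (suc (count (P? ∘ suc))) → Fin (suc n)
  e′ zero    = zero
  e′ (suc a) = suc (e a)
  e′-inj : Injective _≡_ _≡_ e′
  e′-inj {zero}  {zero}  eq = refl
  e′-inj {suc a} {suc b} eq = cong suc (e-inj (Fin.suc-injective eq))
  e′-P : ∀ a → P (e′ a)
  e′-P zero    = p
  e′-P (suc a) = e-P a
  e′-surj : ∀ i → P i → ∃ λ a → e′ a ≡ i
  e′-surj zero    _  = zero , refl
  e′-surj (suc i) pi = suc (proj₁ (e-surj i pi)) , cong suc (proj₂ (e-surj i pi))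
... | no ¬p | e , e-inj , e-P , e-surj = suc ∘ e , e-inj ∘ Fin.suc-injective , e-P , surj
  where
  surj : ∀ i → P i → ∃ λ a → suc (e a) ≡ i
  surj zero    p  = contradiction p ¬p
  surj (suc i) pi = proj₁ (e-surj i pi) , cong suc (proj₂ (e-surj i pi))

-- Repeated indices and the lower bound on the dimension

Repeated : (Fin n → ℚ) → Fin n → Set
Repeated c i = ∃ λ j → toℕ j ℕ.< toℕ i × c j ≡ c i

repeated? : (c : Fin n → ℚ) → ∀ i → Dec (Repeated c i)
repeated? c i = any? (λ j → (toℕ j ℕ.<? toℕ i) ×-dec (c j ℚ.≟ c i))

same-level-repeated : (c : Fin n → ℚ) {i j : Fin n} → ¬ Repeated c i → j ≢ i → c j ≡ c i → Repeated c j
same-level-repeated c {i} {j} fresh j≢i cj≡ci with ℕ.<-cmp (toℕ j) (toℕ i)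
... | tri< j<i _ _ = contradiction (j , j<i , cj≡ci) fresh
... | tri≈ _ j≡i _ = contradiction (toℕ-injective j≡i) j≢i
... | tri> _ _ i<j = i , i<j , sym cj≡ci

dimension : (Fin n → ℚ) → ℕ
dimension c = count (repeated? c)

first-occurrence : (c : Fin n → ℚ) (i : Fin n) → ∃ λ r → c r ≡ c i × ¬ Repeated c r
first-occurrence c i = search (suc (toℕ i)) i ℕ.≤-refl
  where
  search : ∀ b i → toℕ i ℕ.< b → ∃ λ r → c r ≡ c i × ¬ Repeated c r
  search (suc b) i (s≤s i≤b) with repeated? c i
  ... | no fresh             = i , refl , fresh
  ... | yes (j , j<i , cj≡ci) with search b j (ℕ.<-≤-trans j<i i≤b)
  ...   | r , cr≡cj , fresh = r , trans cr≡cj cj≡ci , fresh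

-- `c` is invariant under the transposition of two indices of equal value, so the condition for the
-- new permutation is an instance of the old one.
swapped-compatible : (c : Fin n → ℚ) (w : Permutation′ n) → Compatible c w →
  ∀ i j → c i ≡ c j → Compatible c (swapped i j w)
swapped-compatible c w compat i j ci≡cj l m cl<cm =
  compat _ _ (subst₂ _<_ (sym (level l)) (sym (level m)) cl<cm)
  where
  level : ∀ l → c (transpose i j ⟨$⟩ʳ l) ≡ c l
  level l with l Fin.≟ i
  ... | yes refl = sym ci≡cj
  ... | no l≢i with l Fin.≟ j
  ...   | yes refl = ci≡cj
  ...   | no l≢j   = refl

permutation-injective : (w : Permutation′ n) → ∀ {i j} → w ⟨$⟩ʳ i ≡ w ⟨$⟩ʳ j → i ≡ j
permutation-injective w eq = trans (sym (inverseˡ w)) (trans (cong (w ⟨$⟩ˡ_) eq) (inverseˡ w))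

-- Exchanging the values of w at a repeated index and at the first occurrence of its
-- level changes no other repeated coordinate, so the difference vectors form a
-- diagonal matrix on the repeated coordinates.
independent-vertices : (c : Fin n → ℚ) (w : Permutation′ n) → Compatible c w →
  ∀ {m} → m ℕ.≤ dimension c → HasIndepVertices c m
independent-vertices {n} c w compat {m} m≤dim = v , v-inFace , independent
  where
  open ≡-Reasoning
  repeats = enumerate (repeated? c)
  -- Only `m` of the repeated indices are taken, so that maximality in `FaceDim` can be contradicted
  -- at exactly one dimension more.
  e : Fin m → Fin n
  e a = proj₁ repeats (inject≤ a m≤dim)
  e-injective : ∀ {a b} → e a ≡ e b → a ≡ b
  e-injective eq = inject≤-injective m≤dim m≤dim _ _ (proj₁ (proj₂ repeats) eq)
  e-repeated : ∀ a → Repeated c (e a)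
  e-repeated a = proj₁ (proj₂ (proj₂ repeats)) (inject≤ a m≤dim)
  r : Fin m → Fin n
  r a = proj₁ (first-occurrence c (e a))
  r-level : ∀ a → c (r a) ≡ c (e a)
  r-level a = proj₁ (proj₂ (first-occurrence c (e a)))
  e≢r : ∀ b a → e b ≢ r a
  e≢r b a eq = proj₂ (proj₂ (first-occurrence c (e a))) (subst (Repeated c) eq (e-repeated b))
  v : Fin (suc m) → Permutation′ n
  v zero    = w
  v (suc a) = swapped (e a) (r a) w
  v-inFace : ∀ a → InFace c (v a)
  v-inFace zero    = compatible⇒inFace c w compat
  v-inFace (suc a) = compatible⇒inFace c (v (suc a)) (swapped-compatible c w compat (e a) (r a) (sym (r-level a)))
  independent : AffinelyIndependent (vertex ∘ v)
  -- Coordinate `e b` is moved by the exchange number `b` only: the other exchanges touch different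
  -- repeated indices and first occurrences, which are not repeated.
  independent x dependence b = *-cancel-zero diagonal≢0 (trans (sym row-b) (dependence (e b)))
    where
    entry : Fin m → ℚ
    entry a = x a * (vertex (v (suc a)) (e b) - vertex w (e b))
    off-diagonal : ∀ a → a ≢ b → entry a ≡ 0ℚ
    off-diagonal a a≢b = trans
      (cong (λ u → x a * (ι (suc (toℕ u)) - vertex w (e b)))
        (swapped-other (e a) (r a) w (λ eq → a≢b (sym (e-injective eq))) (e≢r b a)))
      (solve 2 (λ x y → x :* (y :- y) := con 0ℚ) refl (x a) (vertex w (e b)))
    row-b : Σℚ entry ≡ entry b
    row-b = Σℚ-single entry b off-diagonal
    diagonal≢0 : vertex (v (suc b)) (e b) - vertex w (e b) ≢ 0ℚ
    diagonal≢0 eq = e≢r b b (sym (permutation-injective w (toℕ-injective (ℕ.suc-injective (ι-injective (begin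
      ι (suc (toℕ (w ⟨$⟩ʳ r b)))   ≡⟨ cong (λ u → ι (suc (toℕ u))) (swapped-left (e b) (r b) w) ⟨
      vertex (v (suc b)) (e b)     ≡⟨ p-q≡0⇒p≡q eq ⟩
      vertex w (e b)               ∎))))))

-- The upper bound on the dimension

χ-mono : ∀ {P Q : Set} (P? : Dec P) (Q? : Dec Q) → (P → Q) → χ P? ℚ.≤ χ Q?
χ-mono (yes p) Q? f = ≤-reflexive (sym (χ-yes Q? (f p)))
χ-mono (no ¬p) Q? f = proj₁ (χ-bounds Q?)

χ-*-zero : ∀ {P : Set} (P? : Dec P) x → (P → x ≡ 0ℚ) → χ P? * x ≡ 0ℚ
χ-*-zero (yes p) x f = trans (*-identityˡ x) (f p)
χ-*-zero (no _)  x f = *-zeroˡ x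

-- The indicator of an upper set for c is maximised by every vertex of the face of c.
upper-set-sum : (c : Fin n → ℚ) {U : Fin n → Set} (U? : ∀ i → Dec (U i)) →
  (∀ i j → c i ℚ.≤ c j → U i → U j) → (w w′ : Permutation′ n) → Compatible c w → Compatible c w′ →
  Σℚ (λ l → χ (U? l) * (vertex w l - vertex w′ l)) ≡ 0ℚ
upper-set-sum {n} c U? up w w′ compat compat′ = trans (sym (·-difference g w w′))
  (trans (cong (_- g · vertex w′) (≤-antisym (face′ w) (face w′))) (+-inverseʳ (g · vertex w′)))
  where
  g : Fin n → ℚ
  g l = χ (U? l)
  -- Membership in `U` is inherited upwards along `c`, so a strict increase of the indicator forces
  -- a strict increase of `c`.
  coarser : ∀ u → Compatible c u → Compatible g u
  coarser u comp i j gi<gj = comp i j (≰⇒> λ cj≤ci → <-irrefl refl (<-≤-trans gi<gj (χ-mono (U? j) (U? i) (up j i cj≤ci))))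
  face : InFace g w
  face = compatible⇒inFace g w (coarser w compat)
  face′ : InFace g w′
  face′ = compatible⇒inFace g w′ (coarser w′ compat′)

-- The level of `a` is the upper set of values at least `a` minus the upper set of values greater
-- than `a`, and both contribute 0.
level-sum : (c : Fin n → ℚ) (a : ℚ) (w w′ : Permutation′ n) → Compatible c w → Compatible c w′ →
  Σℚ (λ l → χ (c l ℚ.≟ a) * (vertex w l - vertex w′ l)) ≡ 0ℚ
level-sum {n} c a w w′ compat compat′ = begin
  Σℚ (λ l → χ (c l ℚ.≟ a) * d l)                              ≡⟨ Σℚ-cong {n} split ⟩
  Σℚ (λ l → χ (a ℚ.≤? c l) * d l - χ (a ℚ.<? c l) * d l)      ≡⟨ Σℚ-- {n} (λ l → χ (a ℚ.≤? c l) * d l) (λ l → χ (a ℚ.<? c l) * d l) ⟩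
  Σℚ (λ l → χ (a ℚ.≤? c l) * d l) - Σℚ (λ l → χ (a ℚ.<? c l) * d l)
    ≡⟨ cong₂ _-_ (upper-set-sum c (λ l → a ℚ.≤? c l) (λ i j ci≤cj a≤ci → ≤-trans a≤ci ci≤cj) w w′ compat compat′)
                 (upper-set-sum c (λ l → a ℚ.<? c l) (λ i j ci≤cj a<ci → <-≤-trans a<ci ci≤cj) w w′ compat compat′) ⟩
  0ℚ - 0ℚ                                                     ≡⟨ +-inverseʳ 0ℚ ⟩
  0ℚ                                                          ∎
  where
  open ≡-Reasoning
  d : Fin n → ℚ
  d l = vertex w l - vertex w′ l
  difference : ∀ b → χ (b ℚ.≟ a) ≡ χ (a ℚ.≤? b) - χ (a ℚ.<? b)
  difference b with <-cmp a b
  ... | tri< a<b a≢b _ = trans (χ-no (b ℚ.≟ a) (a≢b ∘ sym)) (sym (cong₂ _-_ (χ-yes (a ℚ.≤? b) (<⇒≤ a<b)) (χ-yes (a ℚ.<? b) a<b)))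
  ... | tri≈ a≮b a≡b _ = trans (χ-yes (b ℚ.≟ a) (sym a≡b)) (sym (cong₂ _-_ (χ-yes (a ℚ.≤? b) (≤-reflexive a≡b)) (χ-no (a ℚ.<? b) a≮b)))
  ... | tri> a≮b a≢b b<a = trans (χ-no (b ℚ.≟ a) (a≢b ∘ sym)) (sym (cong₂ _-_ (χ-no (a ℚ.≤? b) (λ a≤b → <-irrefl refl (<-≤-trans b<a a≤b))) (χ-no (a ℚ.<? b) a≮b)))
  split : ∀ l → χ (c l ℚ.≟ a) * d l ≡ χ (a ℚ.≤? c l) * d l - χ (a ℚ.<? c l) * d l
  split l = trans (cong (_* d l) (difference (c l)))
    (solve 3 (λ x y d → (x :- y) :* d := x :* d :- y :* d) refl (χ (a ℚ.≤? c l)) (χ (a ℚ.<? c l)) (d l))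

-- A combination of differences of vertices of the face sums to 0 on every level of c,
-- so it vanishes as soon as its repeated coordinates do.
independent-vertices-bound : (c : Fin n → ℚ) → ∀ {m} → HasIndepVertices c m → m ℕ.≤ dimension c
independent-vertices-bound {n} c {m} (v , inFace , independent) = ℕ.≮⇒≥ λ dim<m →
  -- There is one equation for each repeated coordinate and one unknown for each difference vector.
  -- With more unknowns than equations, a nonzero solution exists and is a forbidden dependence.
  let (x , solves , a , xa≢0) = homogeneous-system dim<m A
  in xa≢0 (independent x (vanishes x solves) a)
  where
  open ≡-Reasoning
  repeats = enumerate (repeated? c)
  e = proj₁ repeats
  d : Fin m → Fin n → ℚ
  d a l = vertex (v (suc a)) l - vertex (v zero) l
  A : Fin (dimension c) → Fin m → ℚ
  A b a = d a (e b)
  compat : ∀ a → Compatible c (v a)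
  compat a = inFace⇒compatible c (v a) (inFace a)
  vanishes : ∀ x → (∀ b → Σℚ (λ a → x a * A b a) ≡ 0ℚ) → ∀ l → Σℚ (λ a → x a * d a l) ≡ 0ℚ
  vanishes x solves = λ l → case-repeated l (repeated? c l)
    where
    D : Fin n → ℚ
    D l = Σℚ (λ a → x a * d a l)
    repeated-zero : ∀ l → Repeated c l → D l ≡ 0ℚ
    repeated-zero l rep = let (b , eb≡l) = proj₂ (proj₂ (proj₂ repeats)) l rep
                          in subst (λ l → D l ≡ 0ℚ) eb≡l (solves b)
    level-zero : ∀ q → Σℚ (λ l → χ (c l ℚ.≟ q) * D l) ≡ 0ℚ
    level-zero q = begin
      Σℚ (λ l → χ (c l ℚ.≟ q) * D l)
        ≡⟨ Σℚ-cong {n} (λ l → sym (Σℚ-*ˡ (χ (c l ℚ.≟ q)) (λ a → x a * d a l))) ⟩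
      Σℚ (λ l → Σℚ (λ a → χ (c l ℚ.≟ q) * (x a * d a l)))
        ≡⟨ Σℚ-comm (λ l a → χ (c l ℚ.≟ q) * (x a * d a l)) ⟩
      Σℚ (λ a → Σℚ (λ l → χ (c l ℚ.≟ q) * (x a * d a l)))
        ≡⟨ Σℚ-zero {m} _ (λ a → begin
             Σℚ (λ l → χ (c l ℚ.≟ q) * (x a * d a l))
               ≡⟨ Σℚ-cong {n} (λ l → solve 3 (λ g x d → g :* (x :* d) := x :* (g :* d)) refl (χ (c l ℚ.≟ q)) (x a) (d a l)) ⟩
             Σℚ (λ l → x a * (χ (c l ℚ.≟ q) * d a l))
               ≡⟨ Σℚ-*ˡ (x a) (λ l → χ (c l ℚ.≟ q) * d a l) ⟩
             x a * Σℚ (λ l → χ (c l ℚ.≟ q) * d a l)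
               ≡⟨ cong (x a *_) (level-sum c q (v (suc a)) (v zero) (compat (suc a)) (compat zero)) ⟩
             x a * 0ℚ
               ≡⟨ *-zeroʳ (x a) ⟩
             0ℚ ∎) ⟩
      0ℚ ∎
    case-repeated : ∀ l → Dec (Repeated c l) → D l ≡ 0ℚ
    case-repeated l (yes rep)  = repeated-zero l rep
    -- All other indices of the level of `l` are repeated, so the level sum, which is 0, reduces to
    -- the coordinate at `l`.
    case-repeated l (no fresh) = begin
      D l                                    ≡⟨ *-identityˡ (D l) ⟨
      1ℚ * D l                               ≡⟨ cong (_* D l) (χ-yes (c l ℚ.≟ c l) refl) ⟨
      χ (c l ℚ.≟ c l) * D l                  ≡⟨ Σℚ-single (λ j → χ (c j ℚ.≟ c l) * D j) l others ⟨
      Σℚ (λ j → χ (c j ℚ.≟ c l) * D j)       ≡⟨ level-zero (c l) ⟩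
      0ℚ                                     ∎
      where
      others : ∀ j → j ≢ l → χ (c j ℚ.≟ c l) * D j ≡ 0ℚ
      others j j≢l = χ-*-zero (c j ℚ.≟ c l) (D j) λ cj≡cl → repeated-zero j (same-level-repeated c fresh j≢l cj≡cl)

-- Permutations and counting

-- Pigeonhole: removing a missed value from the codomain would leave an injection into a smaller
-- finite set.
injective⇒surjective : {f : Fin n → Fin n} → Injective _≡_ _≡_ f → ∀ b → ∃ λ a → f a ≡ b
injective⇒surjective {suc n} {f} inj b with any? (λ a → f a Fin.≟ b)
... | yes hit  = hit
... | no missed = contradiction (injective⇒≤ {f = λ a → punchOut {i = b} (avoids a)} (λ eq → inj (punchOut-injective (avoids _) (avoids _) eq))) ℕ.1+n≰n
  where
  avoids : ∀ a → b ≢ f a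
  avoids a b≡fa = missed (a , sym b≡fa)

injective⇒permutation : (f : Fin n → Fin n) → Injective _≡_ _≡_ f → Permutation′ n
injective⇒permutation f inj = permutation f (λ b → proj₁ (preimage b)) (λ b → proj₂ (preimage b)) (λ a → inj (proj₂ (preimage (f a))))
  where
  preimage = injective⇒surjective inj

𝟙-yes : ∀ {P : Set} (P? : Dec P) → P → 𝟙 P? ≡ 1
𝟙-yes P? p = cong (if_then 1 else 0) (dec-true P? p)

𝟙-no : ∀ {P : Set} (P? : Dec P) → ¬ P → 𝟙 P? ≡ 0
𝟙-no P? ¬p = cong (if_then 1 else 0) (dec-false P? ¬p)

𝟙-cong : ∀ {P Q : Set} (P? : Dec P) (Q? : Dec Q) → (P → Q) → (Q → P) → 𝟙 P? ≡ 𝟙 Q?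
𝟙-cong P? (yes q) f g = 𝟙-yes P? (g q)
𝟙-cong P? (no ¬q) f g = 𝟙-no P? (¬q ∘ f)

𝟙-mono : ∀ {P Q : Set} (P? : Dec P) (Q? : Dec Q) → (P → Q) → 𝟙 P? ℕ.≤ 𝟙 Q?
𝟙-mono (yes p) Q? f = ℕ.≤-reflexive (sym (𝟙-yes Q? (f p)))
𝟙-mono (no ¬p) Q? f = z≤n

count-cong : ∀ {P Q : Fin n → Set} (P? : ∀ i → Dec (P i)) (Q? : ∀ i → Dec (Q i)) →
  (∀ i → P i → Q i) → (∀ i → Q i → P i) → count P? ≡ count Q?
count-cong {zero}  P? Q? f g = refl
count-cong {suc n} P? Q? f g = cong₂ ℕ._+_ (𝟙-cong (P? zero) (Q? zero) (f zero) (g zero)) (count-cong (P? ∘ suc) (Q? ∘ suc) (f ∘ suc) (g ∘ suc))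

count-mono-≤ : ∀ {P Q : Fin n → Set} (P? : ∀ i → Dec (P i)) (Q? : ∀ i → Dec (Q i)) →
  (∀ i → P i → Q i) → count P? ℕ.≤ count Q?
count-mono-≤ {zero}  P? Q? f = z≤n
count-mono-≤ {suc n} P? Q? f = ℕ.+-mono-≤ (𝟙-mono (P? zero) (Q? zero) (f zero)) (count-mono-≤ (P? ∘ suc) (Q? ∘ suc) (f ∘ suc))

count-mono-< : ∀ {P Q : Fin n → Set} (P? : ∀ i → Dec (P i)) (Q? : ∀ i → Dec (Q i)) →
  (∀ i → P i → Q i) → ∀ i → ¬ P i → Q i → count P? ℕ.< count Q?
count-mono-< P? Q? f zero ¬p q = ℕ.+-mono-<-≤
  (subst₂ ℕ._<_ (sym (𝟙-no (P? zero) ¬p)) (sym (𝟙-yes (Q? zero) q)) (s≤s z≤n))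
  (count-mono-≤ (P? ∘ suc) (Q? ∘ suc) (f ∘ suc))
count-mono-< P? Q? f (suc i) ¬p q = ℕ.+-mono-≤-<
  (𝟙-mono (P? zero) (Q? zero) (f zero))
  (count-mono-< (P? ∘ suc) (Q? ∘ suc) (f ∘ suc) i ¬p q)

count-all : count {n} (λ _ → yes tt) ≡ n
count-all {zero}  = refl
count-all {suc n} = cong suc (count-all {n})

count-below : ∀ {n t} → t ℕ.≤ n → count {n} (λ i → toℕ i ℕ.<? t) ≡ t
count-below {zero}  {zero}  t≤n = refl
count-below {suc n} {zero}  t≤n = trans
  (count-cong {n} (λ i → suc (toℕ i) ℕ.<? 0) (λ i → toℕ i ℕ.<? 0) (λ _ ()) (λ _ ()))
  (count-below {n} z≤n)
count-below {suc n} {suc t} (s≤s t≤n) = cong suc (trans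
  (count-cong {n} (λ i → suc (toℕ i) ℕ.<? suc t) (λ i → toℕ i ℕ.<? t) (λ _ → ℕ.s≤s⁻¹) (λ _ → s≤s))
  (count-below {n} t≤n))

count≡sum : ∀ {P : Fin n → Set} (P? : ∀ i → Dec (P i)) → count P? ≡ Sumℕ.sum (λ i → 𝟙 (P? i))
count≡sum {zero}  P? = refl
count≡sum {suc n} P? = cong (𝟙 (P? zero) ℕ.+_) (count≡sum (P? ∘ suc))

count-permute : ∀ {P : Fin n → Set} (P? : ∀ i → Dec (P i)) (w : Permutation′ n) → count (λ i → P? (w ⟨$⟩ʳ i)) ≡ count P?
count-permute P? w = trans (count≡sum (λ i → P? (w ⟨$⟩ʳ i))) (trans (sym (Sumℕ.sum-permute (λ i → 𝟙 (P? i)) w)) (sym (count≡sum P?)))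

-- The lexicographic order and its ranks

Precedes : (Fin n → ℚ) → Fin n → Fin n → Set
Precedes c i j = c i < c j ⊎ (c i ≡ c j × toℕ i ℕ.< toℕ j)

precedes? : (c : Fin n → ℚ) → ∀ i j → Dec (Precedes c i j)
precedes? c i j = (c i ℚ.<? c j) ⊎-dec ((c i ℚ.≟ c j) ×-dec (toℕ i ℕ.<? toℕ j))

precedes-irrefl : (c : Fin n → ℚ) → ∀ i → ¬ Precedes c i i
precedes-irrefl c i (inj₁ ci<ci)    = <-irrefl refl ci<ci
precedes-irrefl c i (inj₂ (_ , i<i)) = ℕ.<-irrefl refl i<i

precedes-trans : (c : Fin n → ℚ) → ∀ {i j k} → Precedes c i j → Precedes c j k → Precedes c i k
precedes-trans c (inj₁ ci<cj)       (inj₁ cj<ck)       = inj₁ (<-trans ci<cj cj<ck)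
precedes-trans c {i} (inj₁ ci<cj)   (inj₂ (cj≡ck , _)) = inj₁ (subst (c i <_) cj≡ck ci<cj)
precedes-trans c {k = k} (inj₂ (ci≡cj , _)) (inj₁ cj<ck) = inj₁ (subst (_< c k) (sym ci≡cj) cj<ck)
precedes-trans c (inj₂ (ci≡cj , i<j)) (inj₂ (cj≡ck , j<k)) = inj₂ (trans ci≡cj cj≡ck , ℕ.<-trans i<j j<k)

precedes-total : (c : Fin n → ℚ) → ∀ {i j} → i ≢ j → Precedes c i j ⊎ Precedes c j i
precedes-total c {i} {j} i≢j with <-cmp (c i) (c j) | ℕ.<-cmp (toℕ i) (toℕ j)
... | tri< ci<cj _ _ | _            = inj₁ (inj₁ ci<cj)
... | tri> _ _ cj<ci | _            = inj₂ (inj₁ cj<ci)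
... | tri≈ _ ci≡cj _ | tri< i<j _ _ = inj₁ (inj₂ (ci≡cj , i<j))
... | tri≈ _ ci≡cj _ | tri≈ _ i≡j _ = contradiction (toℕ-injective i≡j) i≢j
... | tri≈ _ ci≡cj _ | tri> _ _ j<i = inj₂ (inj₂ (sym ci≡cj , j<i))

-- Only strict predecessors are counted, so ranks start at 0 like the spots of the street.
rank : (Fin n → ℚ) → Fin n → ℕ
rank c i = count (λ j → precedes? c j i)

rank<n : (c : Fin n → ℚ) → ∀ i → rank c i ℕ.< n
rank<n {n} c i = subst (rank c i ℕ.<_) (count-all {n})
  (count-mono-< (λ j → precedes? c j i) (λ _ → yes tt) (λ _ _ → tt) i (precedes-irrefl c i) tt)

rank-mono : (c : Fin n → ℚ) → ∀ {i j} → Precedes c i j → rank c i ℕ.< rank c j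
rank-mono c {i} {j} i≺j = count-mono-< (λ l → precedes? c l i) (λ l → precedes? c l j)
  (λ l l≺i → precedes-trans c l≺i i≺j) i (precedes-irrefl c i) i≺j

rank-cancel : (c : Fin n → ℚ) → ∀ {i j} → rank c i ℕ.< rank c j → Precedes c i j
rank-cancel c {i} {j} lt with i Fin.≟ j
... | yes refl = contradiction lt (ℕ.<-irrefl refl)
... | no i≢j with precedes-total c i≢j
...   | inj₁ i≺j = i≺j
...   | inj₂ j≺i = contradiction (rank-mono c j≺i) (ℕ.<-asym lt)

rank-injective : (c : Fin n → ℚ) → ∀ {i j} → rank c i ≡ rank c j → i ≡ j
rank-injective c {i} {j} eq with i Fin.≟ j
... | yes i≡j = i≡j
... | no i≢j with precedes-total c i≢j
...   | inj₁ i≺j = contradiction eq (ℕ.<⇒≢ (rank-mono c i≺j))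
...   | inj₂ j≺i = contradiction (sym eq) (ℕ.<⇒≢ (rank-mono c j≺i))

fromℕ<-permutation : (s : Fin n → ℕ) → (∀ i → s i ℕ.< n) → (∀ {i j} → s i ≡ s j → i ≡ j) → Permutation′ n
fromℕ<-permutation s s<n s-inj = injective⇒permutation (λ i → fromℕ< (s<n i))
  (λ {i} {j} eq → s-inj (trans (sym (toℕ-fromℕ< (s<n i))) (trans (cong toℕ eq) (toℕ-fromℕ< (s<n j)))))

-- The order is total, so the predecessors of `i` are exactly the `j` with `s j < s i`. Since `s` is
-- a permutation of the values below `n`, there are `s i` of them.
rank-unique : (c : Fin n → ℚ) (s : Fin n → ℕ) → (∀ i → s i ℕ.< n) → (∀ {i j} → s i ≡ s j → i ≡ j) →
  (∀ i j → Precedes c i j → s i ℕ.< s j) → ∀ i → rank c i ≡ s i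
rank-unique {n} c s s<n s-inj s-mono i = begin
  count (λ j → precedes? c j i)              ≡⟨ count-cong (λ j → precedes? c j i) (λ j → toℕ (w ⟨$⟩ʳ j) ℕ.<? s i) forth back ⟩
  count (λ j → toℕ (w ⟨$⟩ʳ j) ℕ.<? s i)      ≡⟨ count-permute (λ a → toℕ a ℕ.<? s i) w ⟩
  count {n} (λ a → toℕ a ℕ.<? s i)           ≡⟨ count-below (ℕ.<⇒≤ (s<n i)) ⟩
  s i                                        ∎
  where
  open ≡-Reasoning
  w = fromℕ<-permutation s s<n s-inj
  forth : ∀ j → Precedes c j i → toℕ (w ⟨$⟩ʳ j) ℕ.< s i
  forth j j≺i = subst (ℕ._< s i) (sym (toℕ-fromℕ< (s<n j))) (s-mono j i j≺i)
  back : ∀ j → toℕ (w ⟨$⟩ʳ j) ℕ.< s i → Precedes c j i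
  back j lt with subst (ℕ._< s i) (toℕ-fromℕ< (s<n j)) lt
  ... | sj<si with precedes-total c {j} {i} (λ j≡i → ℕ.<-irrefl (cong s j≡i) sj<si)
  ...   | inj₁ j≺i = j≺i
  ...   | inj₂ i≺j = contradiction (s-mono i j i≺j) (ℕ.<-asym sj<si)

rankPermutation : (c : Fin n → ℚ) → Permutation′ n
rankPermutation c = fromℕ<-permutation (rank c) (rank<n c) (rank-injective c)

toℕ-rankPermutation : (c : Fin n → ℚ) → ∀ i → toℕ (rankPermutation c ⟨$⟩ʳ i) ≡ rank c i
toℕ-rankPermutation c i = toℕ-fromℕ< (rank<n c i)

rankPermutation-compatible : (c : Fin n → ℚ) → Compatible c (rankPermutation c)
rankPermutation-compatible c i j ci<cj = subst₂ ℕ._<_ (sym (toℕ-rankPermutation c i)) (sym (toℕ-rankPermutation c j)) (rank-mono c (inj₁ ci<cj))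

rank-surjective : (c : Fin n → ℚ) → ∀ {t} → t ℕ.< n → ∃ λ i → rank c i ≡ t
rank-surjective c t<n = rankPermutation c ⟨$⟩ˡ fromℕ< t<n ,
  trans (sym (toℕ-rankPermutation c _)) (trans (cong toℕ (inverseʳ (rankPermutation c))) (toℕ-fromℕ< t<n))

-- Provides the earlier car that occupies the preferred spot of car `i`. The index of the preceding
-- rank comes no earlier than the given `k` on the level of `i`, so it lies on that level too and
-- ties are broken by index.
rank-predecessor : (c : Fin n → ℚ) → ∀ i → Repeated c i → ∃ λ j → toℕ j ℕ.< toℕ i × suc (rank c j) ≡ rank c i
rank-predecessor {n} c i (k , k<i , ck≡ci) = j , same-level (rank-cancel c (ℕ.≤-reflexive suc-rank-j)) , suc-rank-j
  where
  rk<ri : rank c k ℕ.< rank c i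
  rk<ri = rank-mono c (inj₂ (ck≡ci , k<i))
  t = ℕ.pred (rank c i)
  suc-t : suc t ≡ rank c i
  suc-t = ℕ.suc-pred (rank c i) {{ℕ.>-nonZero (ℕ.≤-<-trans z≤n rk<ri)}}
  preimage = rank-surjective c {t} (ℕ.<-trans (ℕ.≤-reflexive suc-t) (rank<n c i))
  j = proj₁ preimage
  suc-rank-j : suc (rank c j) ≡ rank c i
  suc-rank-j = trans (cong suc (proj₂ preimage)) suc-t
  same-level : Precedes c j i → toℕ j ℕ.< toℕ i
  same-level (inj₂ (_ , j<i)) = j<i
  same-level (inj₁ cj<ci) = contradiction
    (ℕ.<-≤-trans (rank-mono c {j} {k} (inj₁ (subst (c j <_) (sym ck≡ci) cj<ci))) (ℕ.s≤s⁻¹ (subst (rank c k ℕ.<_) (sym suc-rank-j) rk<ri)))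
    (ℕ.<-irrefl refl)

dimension-unique : (c : Fin n → ℚ) → ∀ {k} → FaceDim c k → dimension c ≡ k
dimension-unique c (independent , maximal) = ℕ.≤-antisym
  (ℕ.≮⇒≥ λ k<dim → maximal (independent-vertices c (rankPermutation c) (rankPermutation-compatible c) k<dim))
  (independent-vertices-bound c independent)

dimension-correct : (c : Fin n → ℚ) → FaceDim c (dimension c)
dimension-correct c = independent-vertices c (rankPermutation c) (rankPermutation-compatible c) ℕ.≤-refl ,
  λ larger → ℕ.1+n≰n (independent-vertices-bound c larger)

-- Parking with displacement at most 1

occupied : ∀ {a occ} → a ∈ occ → isOcc a occ ≡ true
occupied {a} (here refl) rewrite Equivalence.to T-≡ (ℕ.≡⇒≡ᵇ a a refl) = refl
occupied {a} {b ∷ occ} (there a∈occ) with b ≡ᵇ a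
... | true  = refl
... | false = occupied a∈occ

occupied⁻¹ : ∀ a occ → isOcc a occ ≡ true → a ∈ occ
occupied⁻¹ a (b ∷ occ) eq with b ≡ᵇ a in b≡a
... | true  = here (sym (ℕ.≡ᵇ⇒≡ b a (subst T (sym b≡a) tt)))
... | false = there (occupied⁻¹ a occ eq)

vacant : ∀ {a occ} → a ∉ occ → isOcc a occ ≡ false
vacant {a} {occ} a∉occ with isOcc a occ in eq
... | true  = contradiction (occupied⁻¹ a occ eq) a∉occ
... | false = refl

vacant⁻¹ : ∀ {a occ} → isOcc a occ ≡ false → a ∉ occ
vacant⁻¹ eq a∈occ with trans (sym eq) (occupied a∈occ)
... | ()

-- The result of `firstFree` when the displacement is at most 1: only two spots are ever inspected,
-- so the recursion disappears.
Step : ℕ → List ℕ → ℕ → ℕ → Set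
Step n occ a s = s ℕ.< n × s ∉ occ × (s ≡ a ⊎ (s ≡ suc a × a ∈ occ))

m<n⇒n∸m≡suc : ∀ {m n} → m ℕ.< n → n ∸ m ≡ suc (n ∸ suc m)
m<n⇒n∸m≡suc {zero}  {suc n} _         = refl
m<n⇒n∸m≡suc {suc m} {suc n} (s≤s m<n) = m<n⇒n∸m≡suc m<n

n∸m≡suc⇒m<n : ∀ {m n f} → n ∸ m ≡ suc f → m ℕ.< n
n∸m≡suc⇒m<n {zero}  {suc n} _  = s≤s z≤n
n∸m≡suc⇒m<n {suc m} {suc n} eq = s≤s (n∸m≡suc⇒m<n {m} {n} eq)

firstFree-complete : ∀ {n occ a s} → Step n occ a s → firstFree occ a (n ∸ a) ≡ just s
firstFree-complete {n} {occ} {a} (a<n , a∉occ , inj₁ refl)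
  rewrite m<n⇒n∸m≡suc a<n | vacant a∉occ = refl
firstFree-complete {n} {occ} {a} (s<n , s∉occ , inj₂ (refl , a∈occ))
  rewrite m<n⇒n∸m≡suc (ℕ.<-trans (ℕ.n<1+n a) s<n) | occupied a∈occ | m<n⇒n∸m≡suc s<n | vacant s∉occ = refl

firstFree-≥ : ∀ occ a f {s} → firstFree occ a f ≡ just s → a ℕ.≤ s
firstFree-≥ occ a (suc f) eq with isOcc a occ
... | true  = ℕ.<⇒≤ (firstFree-≥ occ (suc a) f eq)
... | false = ℕ.≤-reflexive (just-injective eq)

m∸n≤1⇒2+n≰m : ∀ a {s} → s ∸ a ℕ.≤ 1 → ¬ (suc (suc a) ℕ.≤ s)
m∸n≤1⇒2+n≰m a {s} s∸a≤1 2+a≤s = ℕ.1+n≰n (ℕ.≤-trans (subst (ℕ._≤ s ∸ a) (ℕ.m+n∸n≡m 2 a) (ℕ.∸-monoˡ-≤ a 2+a≤s)) s∸a≤1)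

firstFree-sound : ∀ n occ a {s} → firstFree occ a (n ∸ a) ≡ just s → s ∸ a ℕ.≤ 1 → Step n occ a s
firstFree-sound n occ a eq d≤1 with n ∸ a in fuel
... | suc f with isOcc a occ in occ-a
...   | false with refl ← just-injective eq = n∸m≡suc⇒m<n {a} {n} fuel , vacant⁻¹ occ-a , inj₁ refl
...   | true with f
...     | suc f′ with isOcc (suc a) occ in occ-1+a
-- With both spots taken, the search resumes at `suc (suc a)` and never moves left, so the
-- displacement would be at least 2.
...       | true  = contradiction (firstFree-≥ occ (suc (suc a)) f′ eq) (m∸n≤1⇒2+n≰m a d≤1)
...       | false with refl ← just-injective eq = 1+a<n , vacant⁻¹ occ-1+a , inj₂ (refl , occupied⁻¹ a occ occ-a)
  where
  1+a<n : suc a ℕ.< n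
  1+a<n = n∸m≡suc⇒m<n {suc a} {n} (trans (sym (ℕ.pred[m∸n]≡m∸[1+n] n a)) (cong ℕ.pred fuel))

-- Outcome s of unit-interval preferences a, when the spots in occ are taken beforehand.
record UnitOutcome (n : ℕ) (occ : List ℕ) {m : ℕ} (a s : Fin m → ℕ) : Set where
  field
    bounded   : ∀ i → s i ℕ.< n
    avoids    : ∀ i → s i ∉ occ
    injective : ∀ {i j} → s i ≡ s j → i ≡ j
    step      : ∀ i → s i ≡ a i ⊎ (s i ≡ suc (a i) × (a i ∈ occ ⊎ ∃ λ j → toℕ j ℕ.< toℕ i × s j ≡ a i))

-- The alternative `a i ∈ occ` exists for this induction over the cars: once car 0 has parked, a
-- preference blocked by it becomes a preference for a spot taken beforehand.
outcome-tail : ∀ {n occ} {a s : Fin (suc m) → ℕ} → UnitOutcome n occ a s →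
  UnitOutcome n (s zero ∷ occ) (a ∘ suc) (s ∘ suc)
outcome-tail {m} {n} {occ} {a} {s} o = record
  { bounded   = bounded ∘ suc
  ; avoids    = λ where
      i (here eq)     → contradiction (injective {suc i} {zero} eq) λ ()
      i (there s∈occ) → avoids (suc i) s∈occ
  ; injective = λ eq → Fin.suc-injective (injective eq)
  ; step      = λ i → shift i (step (suc i))
  }
  where
  open UnitOutcome o
  shift : ∀ i → s (suc i) ≡ a (suc i) ⊎ (s (suc i) ≡ suc (a (suc i)) × (a (suc i) ∈ occ ⊎ ∃ λ j → toℕ j ℕ.< suc (toℕ i) × s j ≡ a (suc i))) →
          s (suc i) ≡ a (suc i) ⊎ (s (suc i) ≡ suc (a (suc i)) × (a (suc i) ∈ s zero ∷ occ ⊎ ∃ λ j → toℕ j ℕ.< toℕ i × s (suc j) ≡ a (suc i)))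
  shift i (inj₁ eq)                                 = inj₁ eq
  shift i (inj₂ (eq , inj₁ a∈occ))                  = inj₂ (eq , inj₁ (there a∈occ))
  shift i (inj₂ (eq , inj₂ (zero , _ , s0≡a)))      = inj₂ (eq , inj₁ (here (sym s0≡a)))
  shift i (inj₂ (eq , inj₂ (suc j , s≤s j<i , sj≡a))) = inj₂ (eq , inj₂ (j , j<i , sj≡a))

outcome-head : ∀ {n occ} {a s : Fin (suc m) → ℕ} → UnitOutcome n occ a s → Step n occ (a zero) (s zero)
outcome-head {m} {n} {occ} {a} {s} o = bounded zero , avoids zero , first (step zero)
  where
  open UnitOutcome o
  first : s zero ≡ a zero ⊎ (s zero ≡ suc (a zero) × (a zero ∈ occ ⊎ ∃ λ j → toℕ j ℕ.< 0 × s j ≡ a zero)) →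
          s zero ≡ a zero ⊎ (s zero ≡ suc (a zero) × a zero ∈ occ)
  first (inj₁ eq)                = inj₁ eq
  first (inj₂ (eq , inj₁ a∈occ)) = inj₂ (eq , a∈occ)
  first (inj₂ (_ , inj₂ (_ , () , _)))

outcome-cons : ∀ {n occ} {a : Fin (suc m) → ℕ} {s₀} {s : Fin m → ℕ} → Step n occ (a zero) s₀ →
  UnitOutcome n (s₀ ∷ occ) (a ∘ suc) s → UnitOutcome n occ a (s₀ Vector.∷ s)
outcome-cons {m} {n} {occ} {a} {s₀} {s} (s₀<n , s₀∉occ , move) o = record
  { bounded   = λ where
      zero    → s₀<n
      (suc i) → bounded i
  ; avoids    = λ where
      zero    → s₀∉occ
      (suc i) → avoids i ∘ there
  ; injective = distinct
  ; step      = λ where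
      zero    → first move
      (suc i) → shift i (step i)
  }
  where
  open UnitOutcome o
  s′ : Fin (suc m) → ℕ
  s′ = s₀ Vector.∷ s
  distinct : ∀ {i j} → s′ i ≡ s′ j → i ≡ j
  distinct {zero}  {zero}  eq = refl
  distinct {zero}  {suc j} eq = contradiction (here (sym eq)) (avoids j)
  distinct {suc i} {zero}  eq = contradiction (here eq) (avoids i)
  distinct {suc i} {suc j} eq = cong suc (injective eq)
  first : s₀ ≡ a zero ⊎ (s₀ ≡ suc (a zero) × a zero ∈ occ) →
          s₀ ≡ a zero ⊎ (s₀ ≡ suc (a zero) × (a zero ∈ occ ⊎ ∃ λ j → toℕ j ℕ.< 0 × s′ j ≡ a zero))
  first (inj₁ eq)           = inj₁ eq
  first (inj₂ (eq , a∈occ)) = inj₂ (eq , inj₁ a∈occ)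
  shift : ∀ i → s i ≡ a (suc i) ⊎ (s i ≡ suc (a (suc i)) × (a (suc i) ∈ s₀ ∷ occ ⊎ ∃ λ j → toℕ j ℕ.< toℕ i × s j ≡ a (suc i))) →
          s i ≡ a (suc i) ⊎ (s i ≡ suc (a (suc i)) × (a (suc i) ∈ occ ⊎ ∃ λ j → toℕ j ℕ.< suc (toℕ i) × s′ j ≡ a (suc i)))
  shift i (inj₁ eq)                           = inj₁ eq
  shift i (inj₂ (eq , inj₁ (here a≡s₀)))      = inj₂ (eq , inj₂ (zero , s≤s z≤n , sym a≡s₀))
  shift i (inj₂ (eq , inj₁ (there a∈occ)))    = inj₂ (eq , inj₁ a∈occ)
  shift i (inj₂ (eq , inj₂ (j , j<i , sj≡a))) = inj₂ (eq , inj₂ (suc j , s≤s j<i , sj≡a))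

park-complete : ∀ {n occ} (a s : Fin m → ℕ) → UnitOutcome n occ a s →
  parkFrom n occ (tabulate a) ≡ just (tabulate s)
park-complete {zero}  a s o = refl
park-complete {suc m} {n} {occ} a s o
  rewrite firstFree-complete (outcome-head o) | park-complete (a ∘ suc) (s ∘ suc) (outcome-tail o) = refl

-- The bound on the displacements is what allows each successful search to be read as a `Step`.
park-sound : ∀ {n} occ (a : Fin m → ℕ) {ss} → parkFrom n occ (tabulate a) ≡ just ss →
  All (ℕ._≤ 1) (zipWith _∸_ ss (tabulate a)) → Σ (Fin m → ℕ) λ s → ss ≡ tabulate s × UnitOutcome n occ a s
park-sound {zero}  occ a refl _ = (λ ()) , refl , record
  { bounded = λ () ; avoids = λ () ; injective = λ {} ; step = λ () }
park-sound {suc m} {n} occ a eq all≤1 with firstFree occ (a zero) (n ∸ a zero) in found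
... | just s₀ with parkFrom n (s₀ ∷ occ) (tabulate (a ∘ suc)) in rest
...   | just ss with refl ← just-injective eq with d≤1 ∷ all≤1′ ← all≤1
      with s , refl , o ← park-sound (s₀ ∷ occ) (a ∘ suc) rest all≤1′
      = _ , refl , outcome-cons (firstFree-sound n occ (a zero) found d≤1) o

prefs-tabulate : (α : Vec (Fin n) m) → map toℕ (Vec.toList α) ≡ tabulate (toℕ ∘ Vec.lookup α)
prefs-tabulate []      = refl
prefs-tabulate (x ∷ α) = cong (toℕ x ∷_) (prefs-tabulate α)

zipWith-tabulate : (f g : Fin m → ℕ) → zipWith _∸_ (tabulate f) (tabulate g) ≡ tabulate (λ i → f i ∸ g i)
zipWith-tabulate {zero}  f g = refl
zipWith-tabulate {suc m} f g = cong (f zero ∸ g zero ∷_) (zipWith-tabulate (f ∘ suc) (g ∘ suc))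

-- Faces and parking functions

preference : (Fin n → ℚ) → Fin n → ℕ
preference c i = rank c i ∸ 𝟙 (repeated? c i)

preference<n : (c : Fin n → ℚ) → ∀ i → preference c i ℕ.< n
preference<n c i = ℕ.≤-<-trans (ℕ.m∸n≤m (rank c i) (𝟙 (repeated? c i))) (rank<n c i)

preferences : (Fin n → ℚ) → Vec (Fin n) n
preferences c = Vec.tabulate (λ i → fromℕ< (preference<n c i))

prefs-preferences : (c : Fin n → ℚ) → prefs (preferences c) ≡ tabulate (preference c)
prefs-preferences c = trans (prefs-tabulate (preferences c))
  (tabulate-cong (λ i → trans (cong toℕ (lookup∘tabulate _ i)) (toℕ-fromℕ< (preference<n c i))))

-- The truncated subtraction loses nothing here: some index has the preceding rank, so the rank is
-- positive.
preference-repeated : (c : Fin n → ℚ) → ∀ {i} → Repeated c i → rank c i ≡ suc (preference c i)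
preference-repeated c {i} rep = let (j , _ , eq) = rank-predecessor c i rep in
  trans (sym eq) (cong suc (trans (cong (_∸ 1) eq) (cong (rank c i ∸_) (sym (𝟙-yes (repeated? c i) rep)))))

preference-fresh : (c : Fin n → ℚ) → ∀ {i} → ¬ Repeated c i → rank c i ≡ preference c i
preference-fresh c {i} fresh = cong (rank c i ∸_) (sym (𝟙-no (repeated? c i) fresh))

displacement : (c : Fin n → ℚ) → ∀ i → rank c i ∸ preference c i ≡ 𝟙 (repeated? c i)
displacement c i = by-cases (repeated? c i)
  where
  by-cases : Dec (Repeated c i) → rank c i ∸ preference c i ≡ 𝟙 (repeated? c i)
  by-cases (yes rep)  = trans (cong (_∸ preference c i) (preference-repeated c rep)) (trans (ℕ.m+n∸n≡m 1 (preference c i)) (sym (𝟙-yes (repeated? c i) rep)))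
  by-cases (no fresh) = trans (cong (_∸ preference c i) (preference-fresh c fresh)) (trans (ℕ.n∸n≡0 (preference c i)) (sym (𝟙-no (repeated? c i) fresh)))

rank-outcome : (c : Fin n → ℚ) → UnitOutcome n [] (preference c) (rank c)
rank-outcome c = record
  { bounded   = rank<n c
  ; avoids    = λ i ()
  ; injective = rank-injective c
  ; step      = λ i → by-cases i (repeated? c i)
  }
  where
  by-cases : ∀ i → Dec (Repeated c i) → rank c i ≡ preference c i ⊎
    (rank c i ≡ suc (preference c i) × (_ ⊎ ∃ λ j → toℕ j ℕ.< toℕ i × rank c j ≡ preference c i))
  by-cases i (no fresh) = inj₁ (preference-fresh c fresh)
  by-cases i (yes rep)  = let (j , j<i , eq) = rank-predecessor c i rep
    in inj₂ (preference-repeated c rep , inj₂ (j , j<i , ℕ.suc-injective (trans eq (preference-repeated c rep))))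

park-preferences : (c : Fin n → ℚ) → parkFrom n [] (prefs (preferences c)) ≡ just (tabulate (rank c))
park-preferences {n} c = trans (cong (parkFrom n []) (prefs-preferences c)) (park-complete (preference c) (rank c) (rank-outcome c))

sum-tabulate-𝟙 : ∀ {P : Fin n → Set} (P? : ∀ i → Dec (P i)) → sum (tabulate (λ i → 𝟙 (P? i))) ≡ count P?
sum-tabulate-𝟙 {zero}  P? = refl
sum-tabulate-𝟙 {suc n} P? = cong (𝟙 (P? zero) ℕ.+_) (sum-tabulate-𝟙 (P? ∘ suc))

𝟙≤1 : ∀ {P : Set} (P? : Dec P) → 𝟙 P? ℕ.≤ 1
𝟙≤1 (yes _) = s≤s z≤n
𝟙≤1 (no _)  = z≤n

preferences-unit : (c : Fin n → ℚ) → IsUIPFDisp (dimension c) (preferences c)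
preferences-unit {n} c = tabulate (λ i → 𝟙 (repeated? c i)) , displaced , tabulate⁺ (λ i → 𝟙≤1 (repeated? c i)) , sum-tabulate-𝟙 (repeated? c)
  where
  open ≡-Reasoning
  displaced : displacements (preferences c) ≡ just (tabulate (λ i → 𝟙 (repeated? c i)))
  displaced = begin
    Maybe.map (λ ss → zipWith _∸_ ss (prefs (preferences c))) (parkFrom n [] (prefs (preferences c)))
      ≡⟨ cong (Maybe.map (λ ss → zipWith _∸_ ss (prefs (preferences c)))) (park-preferences c) ⟩
    just (zipWith _∸_ (tabulate (rank c)) (prefs (preferences c)))
      ≡⟨ cong (λ as → just (zipWith _∸_ (tabulate (rank c)) as)) (prefs-preferences c) ⟩
    just (zipWith _∸_ (tabulate (rank c)) (tabulate (preference c)))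
      ≡⟨ cong just (zipWith-tabulate (rank c) (preference c)) ⟩
    just (tabulate (λ i → rank c i ∸ preference c i))
      ≡⟨ cong just (tabulate-cong (displacement c)) ⟩
    just (tabulate (λ i → 𝟙 (repeated? c i))) ∎

-- Corresponds to reverse inclusion of faces: more strict inequalities leave fewer compatible
-- vertices. In both directions together it says that the weak orders agree.
_⊑_ : (c d : Fin n → ℚ) → Set
c ⊑ d = ∀ i j → c i < c j → d i < d j

⊑-equal : {c d : Fin n → ℚ} → c ⊑ d → d ⊑ c → ∀ i j → c i ≡ c j → d i ≡ d j
⊑-equal {c = c} {d} c⊑d d⊑c i j eq with <-cmp (d i) (d j)
... | tri< di<dj _ _ = contradiction eq (<⇒≢ (d⊑c i j di<dj))
... | tri≈ _ di≡dj _ = di≡dj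
... | tri> _ _ dj<di = contradiction (sym eq) (<⇒≢ (d⊑c j i dj<di))

⊑-compatible : {c d : Fin n → ℚ} → d ⊑ c → ∀ w → Compatible c w → Compatible d w
⊑-compatible d⊑c w compat i j di<dj = compat i j (d⊑c i j di<dj)

⊑-inFace : {c d : Fin n → ℚ} → d ⊑ c → ∀ w → InFace c w → InFace d w
⊑-inFace {c = c} {d} d⊑c w face = compatible⇒inFace d w (⊑-compatible d⊑c w (inFace⇒compatible c w face))

-- If d i = d j, the face of d also contains the vertex with the values at i and j exchanged.
inFace-⊑ : (c d : Fin n → ℚ) → (∀ w → InFace d w → InFace c w) → c ⊑ d
-- The rank permutation of `d` is a vertex of both faces, hence `i` precedes `j` lexicographically
-- for `d`, and only a tie has to be excluded.
inFace-⊑ c d d⊆c i j ci<cj = by-cases (rank-cancel d (subst₂ ℕ._<_ (toℕ-rankPermutation d i) (toℕ-rankPermutation d j) wi<wj))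
  where
  compat : ∀ u → Compatible d u → Compatible c u
  compat u comp = inFace⇒compatible c u (d⊆c u (compatible⇒inFace d u comp))
  w = rankPermutation d
  wi<wj : toℕ (w ⟨$⟩ʳ i) ℕ.< toℕ (w ⟨$⟩ʳ j)
  wi<wj = compat w (rankPermutation-compatible d) i j ci<cj
  by-cases : Precedes d i j → d i < d j
  by-cases (inj₁ di<dj)       = di<dj
  by-cases (inj₂ (di≡dj , _)) = contradiction
    (subst₂ (λ a b → toℕ a ℕ.< toℕ b) (swapped-left i j w) (swapped-right i j w)
      (compat (swapped i j w) (swapped-compatible d w (rankPermutation-compatible d) i j di≡dj) i j ci<cj))
    (ℕ.<-asym wi<wj)

preferences-cong : (c d : Fin n → ℚ) → c ⊑ d → d ⊑ c → preferences c ≡ preferences d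
preferences-cong c d c⊑d d⊑c = Vec.tabulate-cong λ i → toℕ-injective
  (trans (toℕ-fromℕ< (preference<n c i)) (trans
    (cong₂ _∸_
      (count-cong (λ j → precedes? c j i) (λ j → precedes? d j i) (λ j → precedes c⊑d d⊑c) (λ j → precedes d⊑c c⊑d))
      (𝟙-cong (repeated? c i) (repeated? d i) (repeated c⊑d d⊑c) (repeated d⊑c c⊑d)))
    (sym (toℕ-fromℕ< (preference<n d i)))))
  where
  precedes : ∀ {c d : Fin _ → ℚ} {i j} → c ⊑ d → d ⊑ c → Precedes c j i → Precedes d j i
  precedes c⊑d d⊑c (inj₁ cj<ci)       = inj₁ (c⊑d _ _ cj<ci)
  precedes c⊑d d⊑c (inj₂ (cj≡ci , j<i)) = inj₂ (⊑-equal c⊑d d⊑c _ _ cj≡ci , j<i)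
  repeated : ∀ {c d : Fin _ → ℚ} {i} → c ⊑ d → d ⊑ c → Repeated c i → Repeated d i
  repeated c⊑d d⊑c (j , j<i , cj≡ci) = j , j<i , ⊑-equal c⊑d d⊑c _ _ cj≡ci

-- c i < c j holds iff some first occurrence r satisfies rank i < rank r ≤ rank j.
rank-⊑ : (c d : Fin n → ℚ) → (∀ i → rank c i ≡ rank d i) → (∀ i → Repeated d i → Repeated c i) → c ⊑ d
rank-⊑ c d same-rank same-repeats i j ci<cj = <-≤-trans di<dr dr≤dj
  where
  occurrence = first-occurrence c j
  r = proj₁ occurrence
  cr≡cj = proj₁ (proj₂ occurrence)
  fresh = proj₂ (proj₂ occurrence)
  from-rank : ∀ {i j} → rank c i ℕ.< rank c j → Precedes d i j
  from-rank {i} {j} lt = rank-cancel d (subst₂ ℕ._<_ (same-rank i) (same-rank j) lt)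
  -- A tie would make `r` repeated for `d`, hence for `c`, although it is a first occurrence.
  di<dr : d i < d r
  di<dr = by-cases (from-rank (rank-mono c (inj₁ (subst (c i <_) (sym cr≡cj) ci<cj))))
    where
    by-cases : Precedes d i r → d i < d r
    by-cases (inj₁ lt)        = lt
    by-cases (inj₂ (eq , i<r)) = contradiction (same-repeats r (i , i<r , eq)) fresh
  -- Otherwise `j` would have smaller rank than `r`, while `r` is the first index of their common
  -- level of `c`.
  dr≤dj : d r ℚ.≤ d j
  dr≤dj = ≮⇒≥ λ dj<dr → by-cases (rank-cancel c (subst₂ ℕ._<_ (sym (same-rank j)) (sym (same-rank r)) (rank-mono d (inj₁ dj<dr))))
    where
    by-cases : ¬ Precedes c j r
    by-cases (inj₁ cj<cr)        = <-irrefl (sym cr≡cj) cj<cr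
    by-cases (inj₂ (eq , j<r)) = fresh (j , j<r , eq)

tabulate-injective : {f g : Fin m → ℕ} → tabulate f ≡ tabulate g → ∀ i → f i ≡ g i
tabulate-injective eq zero    = proj₁ (∷-injective eq)
tabulate-injective eq (suc i) = tabulate-injective (proj₂ (∷-injective eq)) i

-- Parking recovers the ranks as the final spots, and rank minus preference recovers the repeated
-- indices.
preferences-⊑ : (c d : Fin n → ℚ) → preferences c ≡ preferences d → c ⊑ d
preferences-⊑ {n} c d eq = rank-⊑ c d same-rank same-repeats
  where
  same-rank : ∀ i → rank c i ≡ rank d i
  same-rank = tabulate-injective (just-injective (trans (sym (park-preferences c)) (trans (cong (parkFrom n [] ∘ prefs) eq) (park-preferences d))))
  same-preference : ∀ i → preference c i ≡ preference d i
  same-preference = tabulate-injective (trans (sym (prefs-preferences c)) (trans (cong prefs eq) (prefs-preferences d)))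
  same-𝟙 : ∀ i → 𝟙 (repeated? c i) ≡ 𝟙 (repeated? d i)
  same-𝟙 i = trans (sym (displacement c i)) (trans (cong₂ _∸_ (same-rank i) (same-preference i)) (displacement d i))
  𝟙-true : ∀ {P : Set} (P? : Dec P) → 𝟙 P? ≡ 1 → P
  𝟙-true (yes p) _ = p
  same-repeats : ∀ i → Repeated d i → Repeated c i
  same-repeats i rep = 𝟙-true (repeated? c i) (trans (same-𝟙 i) (𝟙-yes (repeated? d i) rep))

-- The functional counts, for each car, the lucky cars parked weakly to its left.
module Functional {n} {a s : Fin n → ℕ} (o : UnitOutcome n [] a s) where
  open UnitOutcome o

  Lucky : Fin n → Set
  Lucky i = s i ≡ a i

  LuckyBefore : Fin n → Fin n → Set
  LuckyBefore i l = Lucky l × s l ℕ.≤ s i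

  luckyBefore? : ∀ i l → Dec (LuckyBefore i l)
  luckyBefore? i l = (s l ℕ.≟ a l) ×-dec (s l ℕ.≤? s i)

  block : Fin n → ℕ
  block i = count (luckyBefore? i)

  functional : Fin n → ℚ
  functional i = ι (block i)

  block-mono : ∀ {i j} → s i ℕ.≤ s j → block i ℕ.≤ block j
  block-mono {i} {j} si≤sj = count-mono-≤ (luckyBefore? i) (luckyBefore? j) (λ l (lucky , sl≤si) → lucky , ℕ.≤-trans sl≤si si≤sj)

  -- Car `j` itself is counted in its own block number but not in that of a car to its left.
  block-lucky : ∀ {i j} → Lucky j → s i ℕ.< s j → block i ℕ.< block j
  block-lucky {i} {j} lucky si<sj = count-mono-< (luckyBefore? i) (luckyBefore? j)
    (λ l (lucky , sl≤si) → lucky , ℕ.≤-trans sl≤si (ℕ.<⇒≤ si<sj)) j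
    (λ (_ , sj≤si) → ℕ.<⇒≱ si<sj sj≤si) (lucky , ℕ.≤-refl)

  unlucky : ∀ i → ¬ Lucky i → s i ≡ suc (a i) × ∃ λ p → toℕ p ℕ.< toℕ i × s p ≡ a i
  unlucky i not-lucky with step i
  ... | inj₁ lucky         = contradiction lucky not-lucky
  ... | inj₂ (eq , inj₂ p) = eq , p

  -- Car `i` is unlucky, as a lucky car would have a larger block number than every car to its left.
  -- So the spot just before it holds an earlier car, and stepping left in this way reaches car `j`.
  -- The recursion is on a bound for the spot.
  block-order : ∀ {i j} → s j ℕ.< s i → block i ℕ.≤ block j → toℕ j ℕ.< toℕ i
  block-order {i} {j} = search (suc (s i)) i ℕ.≤-refl
    where
    search : ∀ b i → s i ℕ.< b → s j ℕ.< s i → block i ℕ.≤ block j → toℕ j ℕ.< toℕ i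
    search (suc b) i (s≤s si≤b) sj<si bi≤bj
      with eq , p , p<i , sp≡ai ← unlucky i (λ lucky → ℕ.<⇒≱ (block-lucky lucky sj<si) bi≤bj)
      with ℕ.m≤n⇒m<n∨m≡n (subst (s j ℕ.≤_) (sym sp≡ai) (ℕ.s≤s⁻¹ (subst (s j ℕ.<_) eq sj<si)))
    ... | inj₂ sj≡sp = subst (λ l → toℕ l ℕ.< toℕ i) (sym (injective sj≡sp)) p<i
    ... | inj₁ sj<sp = ℕ.<-trans (search b p (ℕ.<-≤-trans sp<si si≤b) sj<sp (ℕ.≤-trans (block-mono (ℕ.<⇒≤ sp<si)) bi≤bj)) p<i
      where
      sp<si : s p ℕ.< s i
      sp<si = subst₂ ℕ._<_ (sym sp≡ai) (sym eq) (ℕ.n<1+n (a i))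

  precedes⇒spot-< : ∀ i j → Precedes functional i j → s i ℕ.< s j
  precedes⇒spot-< i j (inj₁ ci<cj) = ℕ.≰⇒> λ sj≤si → ℕ.<⇒≱ (ι-cancel-< {block i} {block j} ci<cj) (block-mono sj≤si)
  precedes⇒spot-< i j (inj₂ (ci≡cj , i<j)) = ℕ.≰⇒> λ sj≤si →
    [ (λ sj<si → ℕ.<-asym i<j (block-order sj<si (ℕ.≤-reflexive (ι-injective ci≡cj))))
    , (λ sj≡si → ℕ.<-irrefl (cong toℕ (injective (sym sj≡si))) i<j)
    ]′ (ℕ.m≤n⇒m<n∨m≡n sj≤si)

  rank≡spot : ∀ i → rank functional i ≡ s i
  rank≡spot = rank-unique functional s bounded injective precedes⇒spot-<

  -- An earlier car of equal value would be parked to the left, but a lucky car starts a new block.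
  lucky⇒fresh : ∀ i → Lucky i → ¬ Repeated functional i
  lucky⇒fresh i lucky (j , j<i , cj≡ci) =
    ℕ.<⇒≢ (block-lucky lucky (precedes⇒spot-< j i (inj₂ (cj≡ci , j<i)))) (ι-injective cj≡ci)

  unlucky⇒repeated : ∀ i → ¬ Lucky i → Repeated functional i
  unlucky⇒repeated i not-lucky = let (eq , p , p<i , sp≡ai) = unlucky i not-lucky in
    p , p<i , cong ι (count-cong (luckyBefore? p) (luckyBefore? i)
      (λ l (lucky , sl≤sp) → lucky , ℕ.≤-trans sl≤sp (ℕ.≤-trans (ℕ.≤-reflexive sp≡ai) (ℕ.≤-trans (ℕ.n≤1+n (a i)) (ℕ.≤-reflexive (sym eq)))))
      -- A lucky car weakly left of `i` is not `i` itself, so it is weakly left of `p`, which is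
      -- parked just before `i`.
      (λ l (lucky , sl≤si) → lucky , ℕ.s≤s⁻¹ (subst (s l ℕ.<_) (trans eq (cong suc (sym sp≡ai)))
        (ℕ.≤∧≢⇒< sl≤si λ sl≡si → not-lucky (subst Lucky (injective sl≡si) lucky)))))

  preference≡a : ∀ i → preference functional i ≡ a i
  preference≡a i = by-cases (s i ℕ.≟ a i)
    where
    by-cases : Dec (Lucky i) → preference functional i ≡ a i
    by-cases (yes lucky)    = trans (sym (preference-fresh functional (lucky⇒fresh i lucky))) (trans (rank≡spot i) lucky)
    by-cases (no not-lucky) = ℕ.suc-injective (trans (sym (preference-repeated functional (unlucky⇒repeated i not-lucky))) (trans (rank≡spot i) (proj₁ (unlucky i not-lucky))))

  dimension≡displacement : dimension functional ≡ sum (tabulate (λ i → s i ∸ a i))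
  dimension≡displacement = trans (sym (sum-tabulate-𝟙 (repeated? functional)))
    (cong sum (tabulate-cong λ i → trans (sym (displacement functional i)) (cong₂ _∸_ (rank≡spot i) (preference≡a i))))

-- Assembling the bijection

parking-functional : ∀ {k} (α : Vec (Fin n) n) → IsUIPFDisp k α → Σ (Fin n → ℚ) λ c → preferences c ≡ α × dimension c ≡ k
parking-functional {n} {k} α (ds , displaced , ds≤1 , total) = by-cases (parkFrom n [] (prefs α)) refl displaced
  where
  by-cases : ∀ r → parkFrom n [] (prefs α) ≡ r → Maybe.map (λ ss → zipWith _∸_ ss (prefs α)) r ≡ just ds →
    Σ (Fin n → ℚ) λ c → preferences c ≡ α × dimension c ≡ k
  by-cases nothing   _      ()
  by-cases (just ss) parked eq = found (park-sound [] a (trans (cong (parkFrom n []) (sym (prefs-tabulate α))) parked)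
      (subst (λ as → All (ℕ._≤ 1) (zipWith _∸_ ss as)) (prefs-tabulate α) (subst (All (ℕ._≤ 1)) (sym (just-injective eq)) ds≤1)))
    where
    a : Fin n → ℕ
    a i = toℕ (Vec.lookup α i)
    found : Σ (Fin n → ℕ) (λ s → ss ≡ tabulate s × UnitOutcome n [] a s) → Σ (Fin n → ℚ) λ c → preferences c ≡ α × dimension c ≡ k
    found (s , ss≡s , o) = functional , preferences≡α , dimension≡k
      where
      open Functional o
      open ≡-Reasoning
      preferences≡α : preferences functional ≡ α
      preferences≡α = trans
        (Vec.tabulate-cong λ i → toℕ-injective (trans (toℕ-fromℕ< (preference<n functional i)) (preference≡a i)))
        (tabulate∘lookup α)
      dimension≡k : dimension functional ≡ k
      dimension≡k = begin
        dimension functional                          ≡⟨ dimension≡displacement ⟩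
        sum (tabulate (λ i → s i ∸ a i))              ≡⟨ cong sum (zipWith-tabulate s a) ⟨
        sum (zipWith _∸_ (tabulate s) (tabulate a))   ≡⟨ cong sum (cong₂ (zipWith _∸_) (sym ss≡s) (sym (prefs-tabulate α))) ⟩
        sum (zipWith _∸_ ss (prefs α))                ≡⟨ cong sum (just-injective eq) ⟩
        sum ds                                        ≡⟨ total ⟩
        k                                             ∎

theorem3p9 : (n k : ℕ) → k ≤ n → Bijection (FaceSetoid n k) (UIPFSetoid n k)
theorem3p9 n k _ = record
  { to        = λ (c , dim) → preferences c , subst (λ k → IsUIPFDisp k (preferences c)) (dimension-unique c dim) (preferences-unit c)
  ; cong      = λ {(c , _)} {(d , _)} → same-face⇒same-preferences c d
  ; bijective = (λ {(c , _)} {(d , _)} eq w → ⊑-inFace (preferences-⊑ d c (sym eq)) w , ⊑-inFace (preferences-⊑ c d eq) w)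
              , λ (α , unit) → let (c , preferences≡α , dimension≡k) = parking-functional α unit
                               in (c , subst (FaceDim c) dimension≡k (dimension-correct c)) ,
                                  -- Surjectivity between setoids asks for the value at every
                                  -- functional that exposes the same face, not only at the one
                                  -- constructed.
                                  λ {(d , _)} same → trans (same-face⇒same-preferences d c same) preferences≡α
  }
  where
  same-face⇒same-preferences : (c d : Fin n → ℚ) →
    (∀ w → (InFace c w → InFace d w) × (InFace d w → InFace c w)) → preferences c ≡ preferences d
  same-face⇒same-preferences c d same = preferences-cong c d
    (inFace-⊑ c d (proj₂ ∘ same)) (inFace-⊑ d c (proj₁ ∘ same))
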